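{- Let $l\ge2$ be fixed and let $\{k_n\}$ be an arbitrary sequence of integers satisfying $1\le k_n\le n-l+1$. Then $$\lim_{n\to\infty}P_n^{\mathrm{sep}}(A^{(n)}_{l;k_n})=(3-2\sqrt2)^{l-1}\,|S_l^{\mathrm{sep}}|.$$ In particular, for $l=3$, $$\lim_{n\to\infty}P_n^{\mathrm{sep}}(A^{(n)}_{3;k_n})=6(3-2\sqrt2)^2,$$ and for $l=4$, $$\lim_{n\to\infty}P_n^{\mathrm{sep}}(A^{(n)}_{4;k_n})=22(3-2\sqrt2)^3.$$
   Context: $S_n$ is the set of permutations of $[n]=\{1,\dots,n\}$, written $\sigma=\sigma_1\sigma_2\cdots\sigma_n$. For $l\in\{2,\dots,n-1\}$ and $k\ge1$ with $k+l-1\le n$, $A^{(n)}_{l;k}\subset S_n$ is the set of $\sigma\in S_n$ for which there exists $a$ with $\{k,k+1,\dots,k+l-1\}=\{\sigma_a,\sigma_{a+1},\dots,\sigma_{a+l-1}\}$. A permutation is separable if it can be constructed from the singleton in $S_1$ by iterating direct sums and skew sums; equivalently (a known result), if it avoids both patterns $2413$ and $3142$. Here $\sigma\in S_n$ contains $\tau\in S_m$ as a pattern if there are indices $1\le i_1<\cdots<i_m\le n$ such that for all $1\le j,j'\le m$, $\sigma_{i_j}<\sigma_{i_{j'}}$ if and only if $\tau_j<\tau_{j'}$; otherwise $\sigma$ avoids $\tau$. $S_n^{\mathrm{sep}}$ is the set of separable permutations in $S_n$, and $P_n^{\mathrm{sep}}$ is the uniform probability measure on $S_n^{\mathrm{sep}}$,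 so $P_n^{\mathrm{sep}}(A)=|A\cap S_n^{\mathrm{sep}}|/|S_n^{\mathrm{sep}}|$ for $A\subset S_n$. -}

module Defs where

open import Data.Empty using (⊥-elim)
open import Data.Integer as ℤ using (+_)
import Data.Integer.Properties as ℤ
import Data.Integer.Tactic.RingSolver as ℤSolver
open import Data.List as List
  using (List; []; _∷_; [_]; _++_; map; concatMap; filter; length; take; drop; applyUpTo)
import Data.List.Properties as List
open import Data.List.Membership.Propositional using (_∈_; _∉_; find; lose)
open import Data.List.Membership.Propositional.Properties
open import Data.List.Relation.Binary.BagAndSetEquality using (_∼[_]_; set)
open import Data.List.Relation.Binary.Disjoint.Propositional using (Disjoint)
open import Data.List.Relation.Binary.Permutation.Propositional
  using (_↭_; prep; ↭-refl; ↭-sym; ↭-trans; ↭-swap)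
import Data.List.Relation.Binary.Permutation.Propositional.Properties as ↭
open import Data.List.Relation.Unary.All as All using (All; []; _∷_)
import Data.List.Relation.Unary.All.Properties as All
open import Data.List.Relation.Unary.Any using (Any; here; there)
open import Data.List.Relation.Unary.AllPairs using ([]; _∷_)
open import Data.List.Relation.Unary.Unique.Propositional using (Unique)
import Data.List.Relation.Unary.Unique.Propositional.Properties as Unique
open import Data.List.Membership.DecPropositional using (_∈?_)
open import Data.Nat as ℕ using (ℕ; zero; suc; s≤s; z≤n; NonZero)
import Data.Nat.Properties as ℕ
import Data.Nat.Tactic.RingSolver as ℕSolver
open import Data.Product using (∃; ∃₂; _×_; _,_; proj₁; proj₂)
open import Data.Rational as ℚ using (ℚ; 0ℚ; 1ℚ; ½; _/_; mkℚ; toℚᵘ)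
import Data.Rational.Properties as ℚ
open import Data.Rational.Solver using (module +-*-Solver)
open import Data.Rational.Unnormalised as ℚᵘ using (mkℚᵘ; *≤*; *<*; *≡*)
import Data.Rational.Unnormalised.Properties as ℚᵘ
open import Data.Sum using (_⊎_; inj₁; inj₂)
open import Function using (_∘_; _|>_; _⇔_; mk⇔; Equivalence)
open import Level using (0ℓ)
open import Relation.Binary.PropositionalEquality
  using (_≡_; refl; sym; trans; cong; cong₂; subst; subst₂)
open import Relation.Nullary using (Dec; yes; no; map′; _×-dec_; _⊎-dec_)
open import Relation.Unary using (Pred; Decidable)

-- Permutations in one-line notation: σ₁σ₂⋯σₙ is the list σ₁ ∷ σ₂ ∷ ⋯ ∷ σₙ ∷ []
-- over {1,…,n}.

[1⋯_] : ℕ → List ℕ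
[1⋯ n ] = applyUpTo suc n

module _ {A : Set} where

  insertions : A → List A → List (List A)
  insertions x []       = [ [ x ] ]
  insertions x (y ∷ ys) = (x ∷ y ∷ ys) ∷ map (y ∷_) (insertions x ys)

  permutations : List A → List (List A)
  permutations []       = [ [] ]
  permutations (x ∷ xs) = concatMap (insertions x) (permutations xs)

S : ℕ → List (List ℕ)
S n = permutations [1⋯ n ]

private module _ {A : Set} where

  insertions-↭ : ∀ {x : A} ys {zs} → zs ∈ insertions x ys → zs ↭ x ∷ ys
  insertions-↭ []       (here refl) = ↭-refl
  insertions-↭ (y ∷ ys) (here refl) = ↭-refl
  insertions-↭ (y ∷ ys) (there zs∈) with ∈-map⁻ (y ∷_) zs∈
  ... | ws , ws∈ , refl =
    ↭-trans (prep y (insertions-↭ ys ws∈)) (↭-swap y _ ↭-refl)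

  ∈-insertions : ∀ (x : A) as bs → as ++ x ∷ bs ∈ insertions x (as ++ bs)
  ∈-insertions x []       []       = here refl
  ∈-insertions x []       (b ∷ bs) = here refl
  ∈-insertions x (a ∷ as) bs       =
    there (∈-map⁺ (a ∷_) (∈-insertions x as bs))

  permutations-sound : ∀ xs {zs : List A} → zs ∈ permutations xs → zs ↭ xs
  permutations-sound []       (here refl) = ↭-refl
  permutations-sound (x ∷ xs) zs∈
    with ∈-concatMap⁻ (insertions x) {xs = permutations xs} zs∈
  ... | p = go (permutations xs) (permutations-sound xs) p
    where
    go : ∀ yss → (∀ {ys} → ys ∈ yss → ys ↭ xs) → ∀ {zs} →
         Any ((zs ∈_) ∘ insertions x) yss → zs ↭ x ∷ xs
    go (ys ∷ _) h (here q)  = ↭-trans (insertions-↭ ys q) (prep x (h (here refl)))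
    go (_ ∷ ys) h (there q) = go ys (h ∘ there) q

  permutations-complete : ∀ xs {zs : List A} → (zs ↭ xs) → zs ∈ permutations xs
  permutations-complete []       p rewrite ↭.↭-empty-inv p = here refl
  permutations-complete (x ∷ xs) p
    with ∈-∃++ (↭.∈-resp-↭ (↭-sym p) (here refl))
  ... | as , bs , refl =
    ∈-concatMap⁺ (insertions x) (lose
      (permutations-complete xs (↭.drop-mid as [] p)) (∈-insertions x as bs))

  insertions-unique : ∀ {x : A} ys → x ∉ ys → Unique (insertions x ys)
  insertions-unique []       x∉ = [] ∷ []
  insertions-unique {x} (y ∷ ys) x∉ =
    All.tabulate (λ z∈ eq → x∉ (here (List.∷-injectiveˡ
      (trans eq (proj₂ (proj₂ (∈-map⁻ (y ∷_) z∈)))))))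
    ∷ Unique.map⁺ List.∷-injectiveʳ (insertions-unique ys (x∉ ∘ there))

  insertions-injective : ∀ {x : A} {zs} ys ys′ → x ∉ ys → x ∉ ys′ →
    zs ∈ insertions x ys → zs ∈ insertions x ys′ → ys ≡ ys′
  insertions-injective [] [] _ _ _ _ = refl
  insertions-injective [] (y ∷ ys) _ x∉ (here refl) (there q)
    with ∈-map⁻ (y ∷_) q
  ... | _ , _ , refl = ⊥-elim (x∉ (here refl))
  insertions-injective (y ∷ ys) [] x∉ _ (there q) (here refl)
    with ∈-map⁻ (y ∷_) q
  ... | _ , _ , refl = ⊥-elim (x∉ (here refl))
  insertions-injective (y ∷ ys) (y′ ∷ ys′) _ _ (here refl) (here refl) = refl
  insertions-injective (y ∷ ys) (y′ ∷ ys′) _ x∉ (here refl) (there q)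
    with ∈-map⁻ (y′ ∷_) q
  ... | _ , _ , refl = ⊥-elim (x∉ (here refl))
  insertions-injective (y ∷ ys) (y′ ∷ ys′) x∉ _ (there q) (here refl)
    with ∈-map⁻ (y ∷_) q
  ... | _ , _ , refl = ⊥-elim (x∉ (here refl))
  insertions-injective (y ∷ ys) (y′ ∷ ys′) x∉ x∉′ (there q) (there q′)
    with ∈-map⁻ (y ∷_) q | ∈-map⁻ (y′ ∷_) q′
  ... | _ , r , refl | _ , r′ , refl =
    cong (y ∷_) (insertions-injective ys ys′ (x∉ ∘ there) (x∉′ ∘ there) r r′)

  permutations-unique : ∀ {xs : List A} → Unique xs → Unique (permutations xs)
  permutations-unique [] = [] ∷ []
  permutations-unique {x ∷ xs} (x∉ ∷ u) =
    go (permutations xs) (permutations-unique u)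
       (λ ys∈ x∈ → All.lookup x∉ (↭.∈-resp-↭ (permutations-sound xs ys∈) x∈) refl)
    where
    go : ∀ yss → Unique yss → (∀ {ys} → ys ∈ yss → x ∉ ys) →
         Unique (concatMap (insertions x) yss)
    go []         _        _ = []
    go (ys ∷ yss) (n ∷ us) h =
      Unique.++⁺ (insertions-unique ys (h (here refl))) (go yss us (h ∘ there)) disj
      where
      disj : Disjoint (insertions x ys) (concatMap (insertions x) yss)
      disj (p , q) with find (∈-concatMap⁻ (insertions x) {xs = yss} q)
      ... | ws , ws∈ , q′ = All.lookup n ws∈
        (insertions-injective ys ws (h (here refl)) (h (there ws∈)) p q′)

∈-S : ∀ n {σ} → σ ∈ S n ⇔ (σ ↭ [1⋯ n ])
∈-S n = mk⇔ (permutations-sound [1⋯ n ]) (permutations-complete [1⋯ n ])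

S-unique : ∀ n → Unique (S n)
S-unique n = permutations-unique
  (Unique.applyUpTo⁺₁ suc n (λ i<j _ → ℕ.<⇒≢ i<j ∘ ℕ.suc-injective))

infixl 6 _⊕_ _⊖_

_⊕_ : List ℕ → List ℕ → List ℕ
σ ⊕ τ = σ ++ map (length σ ℕ.+_) τ

_⊖_ : List ℕ → List ℕ → List ℕ
σ ⊖ τ = map (length τ ℕ.+_) σ ++ τ

data Separable : List ℕ → Set where
  singleton : Separable [ 1 ]
  direct    : ∀ {σ τ} → Separable σ → Separable τ → Separable (σ ⊕ τ)
  skew      : ∀ {σ τ} → Separable σ → Separable τ → Separable (σ ⊖ τ)

private
  _≟ᴸ_ : (σ τ : List ℕ) → Dec (σ ≡ τ)
  _≟ᴸ_ = List.≡-dec ℕ._≟_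

  sep-length : ∀ {σ} → Separable σ → 0 ℕ.< length σ
  sep-length singleton = s≤s z≤n
  sep-length (direct {σ} {τ} p q)
    rewrite List.length-++ σ {map (length σ ℕ.+_) τ} = ℕ.≤-trans (sep-length p) (ℕ.m≤m+n _ _)
  sep-length (skew {σ} {τ} p q)
    rewrite List.length-++ (map (length τ ℕ.+_) σ) {τ} = ℕ.≤-trans (sep-length q) (ℕ.m≤n+m _ _)

  take-++ : (as bs : List ℕ) → take (length as) (as ++ bs) ≡ as
  take-++ []       bs = refl
  take-++ (a ∷ as) bs = cong (a ∷_) (take-++ as bs)

  drop-++ : (as bs : List ℕ) → drop (length as) (as ++ bs) ≡ bs
  drop-++ []       bs = refl
  drop-++ (a ∷ as) bs = drop-++ as bs

  lower : ℕ → List ℕ → List ℕ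
  lower m = map (ℕ._∸ m)

  lower-raise : ∀ m σ → lower m (map (m ℕ.+_) σ) ≡ σ
  lower-raise m []      = refl
  lower-raise m (x ∷ σ) = cong₂ _∷_ (ℕ.m+n∸m≡n m x) (lower-raise m σ)

  Direct Skew : List ℕ → ℕ → Set
  Direct σ i = let α = take i σ ; β = lower i (drop i σ) in
    α ⊕ β ≡ σ × Separable α × Separable β
  Skew σ i = let β = drop i σ ; α = lower (length β) (take i σ) in
    α ⊖ β ≡ σ × Separable α × Separable β

  Split : List ℕ → Set
  Split σ = σ ≡ [ 1 ] ⊎ ∃ λ j → j ℕ.< ℕ.pred (length σ) × (Direct σ (suc j) ⊎ Skew σ (suc j))

  split⇒sep : ∀ {σ} → Split σ → Separable σ
  split⇒sep (inj₁ refl) = singleton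
  split⇒sep (inj₂ (_ , _ , inj₁ (eq , p , q))) = subst Separable eq (direct p q)
  split⇒sep (inj₂ (_ , _ , inj₂ (eq , p , q))) = subst Separable eq (skew p q)

  index : ∀ (σ τ : List ℕ) → 0 ℕ.< length σ → 0 ℕ.< length τ →
          ∃ λ j → suc j ≡ length σ × j ℕ.< ℕ.pred (length (σ ++ τ))
  index (x ∷ σ) τ _ q rewrite List.length-++ σ {τ} =
    length σ , refl , ℕ.m<m+n (length σ) q

  sep⇒split : ∀ {σ} → Separable σ → Split σ
  sep⇒split singleton = inj₁ refl
  sep⇒split (direct {σ} {τ} p q)
    with index σ (map (length σ ℕ.+_) τ) (sep-length p)
           (subst (0 ℕ.<_) (sym (List.length-map _ τ)) (sep-length q))
  ... | j , eq , j< = inj₂ (j , j< , inj₁ (subst (Direct (σ ⊕ τ)) (sym eq) lem))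
    where
    lem : Direct (σ ⊕ τ) (length σ)
    lem rewrite take-++ σ (map (length σ ℕ.+_) τ) | drop-++ σ (map (length σ ℕ.+_) τ)
              | lower-raise (length σ) τ = refl , p , q
  sep⇒split (skew {σ} {τ} p q)
    with index (map (length τ ℕ.+_) σ) τ
           (subst (0 ℕ.<_) (sym (List.length-map _ σ)) (sep-length p)) (sep-length q)
  ... | j , eq , j< = inj₂ (j , j< , inj₂ (subst (Skew (σ ⊖ τ)) (sym eq) lem))
    where
    σ′ = map (length τ ℕ.+_) σ
    lem : Skew (σ ⊖ τ) (length σ′)
    lem rewrite take-++ σ′ τ | drop-++ σ′ τ
              | lower-raise (length τ) σ = refl , p , q

  sep-dec : ∀ fuel σ → length σ ℕ.≤ fuel → Dec (Separable σ)
  sep-dec zero       []      _ = no λ p → ℕ.<-irrefl refl (sep-length p)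
  sep-dec (suc fuel) σ       σ≤ = map′ split⇒sep sep⇒split
    ((σ ≟ᴸ [ 1 ]) ⊎-dec
      map′ (λ (j , j< , q) → j , j< , proj₂ q) (λ (j , j< , q) → j , j< , (j< , q))
        (ℕ.anyUpTo? P? (ℕ.pred (length σ))))
    where
    P : ℕ → Set
    P j = j ℕ.< ℕ.pred (length σ) × (Direct σ (suc j) ⊎ Skew σ (suc j))

    pred≤ : ℕ.pred (length σ) ℕ.≤ fuel
    pred≤ = ℕ.pred-mono-≤ σ≤

    P? : Decidable P
    P? j with j ℕ.<? ℕ.pred (length σ)
    ... | no ≮  = no (≮ ∘ proj₁)
    ... | yes j< = map′ (j< ,_) proj₂
      ((((take i σ ⊕ lower i (drop i σ)) ≟ᴸ σ) ×-dec
         (sep-dec fuel (take i σ) take≤ ×-dec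
          sep-dec fuel (lower i (drop i σ)) (lower≤ i (drop i σ) drop≤)))
       ⊎-dec
       (((lower (length (drop i σ)) (take i σ) ⊖ drop i σ) ≟ᴸ σ) ×-dec
         (sep-dec fuel (lower (length (drop i σ)) (take i σ)) (lower≤ (length (drop i σ)) (take i σ) take≤) ×-dec
          sep-dec fuel (drop i σ) drop≤)))
      where
      i = suc j
      lower≤ : ∀ m τ → length τ ℕ.≤ fuel → length (lower m τ) ℕ.≤ fuel
      lower≤ m τ h = subst (ℕ._≤ fuel) (sym (List.length-map _ τ)) h
      take≤ : length (take i σ) ℕ.≤ fuel
      take≤ rewrite List.length-take i σ =
        ℕ.≤-trans (ℕ.m⊓n≤m i (length σ)) (ℕ.≤-trans j< pred≤)
      drop≤ : length (drop i σ) ℕ.≤ fuel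
      drop≤ rewrite List.length-drop i σ =
        ℕ.≤-trans (ℕ.∸-monoʳ-≤ (length σ) (s≤s (z≤n {j})))
          (subst (ℕ._≤ fuel) (sym (ℕ.pred[m∸n]≡m∸[1+n] (length σ) 0)) pred≤)

separable? : Decidable Separable
separable? σ = sep-dec (length σ) σ ℕ.≤-refl

Ssep : ℕ → List (List ℕ)
Ssep n = filter separable? (S n)

private
  shift-applyUpTo : ∀ (f : ℕ → ℕ) n → map suc (applyUpTo f n) ≡ applyUpTo (suc ∘ f) n
  shift-applyUpTo f n = List.map-applyUpTo f suc n

  identity-separable : ∀ n → Separable [1⋯ suc n ]
  identity-separable zero    = singleton
  identity-separable (suc n) =
    subst (λ τ → Separable (1 ∷ τ)) (shift-applyUpTo suc (suc n))
      (direct singleton (identity-separable n))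

∣Ssep∣-nonZero : ∀ n → NonZero (length (Ssep (suc n)))
∣Ssep∣-nonZero n with Ssep (suc n)
  | ∈-filter⁺ separable? (permutations-complete [1⋯ suc n ] ↭-refl) (identity-separable n)
... | _ ∷ _ | _ = _

-- Since Ssep 0 is empty, the value at n = 0 is a dummy.
Psep : (n : ℕ) {P : Pred (List ℕ) 0ℓ} → Decidable P → ℚ
Psep zero    P? = 0ℚ
Psep (suc n) P? =
  _/_ (+ length (filter P? (Ssep (suc n)))) (length (Ssep (suc n))) {{∣Ssep∣-nonZero n}}

-- Positions are counted from 0 here: a stands for the index a + 1 into σ.
A : (l k : ℕ) → Pred (List ℕ) 0ℓ
A l k σ = ∃ λ a → a ℕ.+ l ℕ.≤ length σ ×
                  take l (drop a σ) ∼[ set ] applyUpTo (k ℕ.+_) l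

private
  set? : (xs ys : List ℕ) → Dec (xs ∼[ set ] ys)
  set? xs ys = map′
    (λ (f , g) → mk⇔ (All.lookup f) (All.lookup g))
    (λ e → All.tabulate (Equivalence.to e) , All.tabulate (Equivalence.from e))
    (All.all? (λ x → _∈?_ ℕ._≟_ x ys) xs ×-dec All.all? (λ y → _∈?_ ℕ._≟_ y xs) ys)

A? : ∀ l k → Decidable (A l k)
A? l k σ = map′
  (λ (a , _ , p) → a , p)
  (λ p → proj₁ p , s≤s (ℕ.≤-trans (ℕ.m≤m+n (proj₁ p) l) (proj₁ (proj₂ p))) , proj₂ p)
  (ℕ.anyUpTo? (λ a → (a ℕ.+ l ℕ.≤? length σ) ×-dec
                     set? (take l (drop a σ)) (applyUpTo (k ℕ.+_) l))
              (suc (length σ)))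

-- The library has no reals.  They are Cauchy sequences of rationals with an
-- explicit modulus of convergence (the Σ below); the intended equality is _≃ᴿ_.

IsCauchy : (ℕ → ℚ) → Set
IsCauchy x = ∀ ε → 0ℚ ℚ.< ε →
  ∃ λ N → ∀ m n → N ℕ.≤ m → N ℕ.≤ n → ℚ.∣ x m ℚ.- x n ∣ ℚ.< ε

record ℝ : Set where
  constructor mkℝ
  field
    seq    : ℕ → ℚ
    cauchy : IsCauchy seq

open ℝ public

private
  open +-*-Solver using (solve; _:+_; _:*_; :-_; _:-_; _:=_)

  half : ∀ {ε} → 0ℚ ℚ.< ε → 0ℚ ℚ.< ½ ℚ.* ε
  half {ε} 0<ε = subst (ℚ._< ½ ℚ.* ε) (ℚ.*-zeroʳ ½) (ℚ.*-monoʳ-<-pos ½ 0<ε)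

  halves : ∀ ε → ½ ℚ.* ε ℚ.+ ½ ℚ.* ε ≡ ε
  halves ε = trans (sym (ℚ.*-distribʳ-+ ε ½ ½)) (ℚ.*-identityˡ ε)

  ∣p-q∣< : ∀ p q {ε} → p ℚ.- q ℚ.< ε → q ℚ.- p ℚ.< ε → ℚ.∣ p ℚ.- q ∣ ℚ.< ε
  ∣p-q∣< p q {ε} h h′ with ℚ.∣p∣≡p∨∣p∣≡-p (p ℚ.- q)
  ... | inj₁ eq = subst (ℚ._< ε) (sym eq) h
  ... | inj₂ eq = subst (ℚ._< ε)
    (sym (trans eq (solve 2 (λ a b → :- (a :- b) := b :- a) refl p q))) h′

  ∣p∣≤∣p-q∣+∣q∣ : ∀ p q → ℚ.∣ p ∣ ℚ.≤ ℚ.∣ p ℚ.- q ∣ ℚ.+ ℚ.∣ q ∣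
  ∣p∣≤∣p-q∣+∣q∣ p q = subst (λ r → ℚ.∣ r ∣ ℚ.≤ ℚ.∣ p ℚ.- q ∣ ℚ.+ ℚ.∣ q ∣)
    (solve 2 (λ a b → (a :- b) :+ b := a) refl p q)
    (ℚ.∣p+q∣≤∣p∣+∣q∣ (p ℚ.- q) q)

  ∣p∣-∣q∣≤∣p-q∣ : ∀ p q → ℚ.∣ p ∣ ℚ.- ℚ.∣ q ∣ ℚ.≤ ℚ.∣ p ℚ.- q ∣
  ∣p∣-∣q∣≤∣p-q∣ p q = subst (ℚ.∣ p ∣ ℚ.- ℚ.∣ q ∣ ℚ.≤_)
    (solve 2 (λ a b → a :+ b :- b := a) refl ℚ.∣ p ℚ.- q ∣ ℚ.∣ q ∣)
    (ℚ.+-monoˡ-≤ (ℚ.- ℚ.∣ q ∣) (∣p∣≤∣p-q∣+∣q∣ p q))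

  const-cauchy : ∀ q → IsCauchy (λ _ → q)
  const-cauchy q ε 0<ε = 0 , λ _ _ _ _ → subst (ℚ._< ε) (sym (cong ℚ.∣_∣ (ℚ.+-inverseʳ q))) 0<ε

  +-cauchy : ∀ {x y} → IsCauchy x → IsCauchy y → IsCauchy (λ n → x n ℚ.+ y n)
  +-cauchy {x} {y} cx cy ε 0<ε with cx (½ ℚ.* ε) (half 0<ε) | cy (½ ℚ.* ε) (half 0<ε)
  ... | M , hx | N , hy = M ℕ.⊔ N , λ m n m≥ n≥ → let open ℚ.≤-Reasoning in begin-strict
    ℚ.∣ (x m ℚ.+ y m) ℚ.- (x n ℚ.+ y n) ∣
      ≡⟨ cong ℚ.∣_∣ (solve 4 (λ a b c d → (a :+ b) :- (c :+ d) := (a :- c) :+ (b :- d))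
           refl (x m) (y m) (x n) (y n)) ⟩
    ℚ.∣ (x m ℚ.- x n) ℚ.+ (y m ℚ.- y n) ∣
      ≤⟨ ℚ.∣p+q∣≤∣p∣+∣q∣ (x m ℚ.- x n) (y m ℚ.- y n) ⟩
    ℚ.∣ x m ℚ.- x n ∣ ℚ.+ ℚ.∣ y m ℚ.- y n ∣
      <⟨ ℚ.+-mono-< (hx m n (ℕ.m⊔n≤o⇒m≤o M N m≥) (ℕ.m⊔n≤o⇒m≤o M N n≥))
                    (hy m n (ℕ.m⊔n≤o⇒n≤o M N m≥) (ℕ.m⊔n≤o⇒n≤o M N n≥)) ⟩
    ½ ℚ.* ε ℚ.+ ½ ℚ.* ε
      ≡⟨ halves ε ⟩
    ε ∎

  neg-cauchy : ∀ {x} → IsCauchy x → IsCauchy (λ n → ℚ.- x n)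
  neg-cauchy {x} cx ε 0<ε with cx ε 0<ε
  ... | N , h = N , λ m n m≥ n≥ → subst (ℚ._< ε)
    (trans (sym (ℚ.∣-p∣≡∣p∣ (x m ℚ.- x n)))
      (cong ℚ.∣_∣ (solve 2 (λ a b → :- (a :- b) := :- a :- (:- b)) refl (x m) (x n))))
    (h m n m≥ n≥)

  ∣∣-cauchy : ∀ {x} → IsCauchy x → IsCauchy (λ n → ℚ.∣ x n ∣)
  ∣∣-cauchy {x} cx ε 0<ε with cx ε 0<ε
  ... | N , h = N , λ m n m≥ n≥ → ∣p-q∣< ℚ.∣ x m ∣ ℚ.∣ x n ∣
    (ℚ.≤-<-trans (∣p∣-∣q∣≤∣p-q∣ (x m) (x n)) (h m n m≥ n≥))
    (ℚ.≤-<-trans (∣p∣-∣q∣≤∣p-q∣ (x n) (x m)) (h n m n≥ m≥))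

  0<1 : 0ℚ ℚ.< 1ℚ
  0<1 = ℚ.positive⁻¹ 1ℚ

  bounded : ∀ {x} → IsCauchy x → ∃₂ λ B N → 0ℚ ℚ.< B × (∀ n → N ℕ.≤ n → ℚ.∣ x n ∣ ℚ.≤ B)
  bounded {x} cx with cx 1ℚ 0<1
  ... | N , h = 1ℚ ℚ.+ ℚ.∣ x N ∣ , N
    , ℚ.+-mono-<-≤ 0<1 (ℚ.0≤∣p∣ (x N))
    , λ n n≥ → ℚ.≤-trans (∣p∣≤∣p-q∣+∣q∣ (x n) (x N))
        (ℚ.+-monoˡ-≤ ℚ.∣ x N ∣ (ℚ.<⇒≤ (h n N n≥ ℕ.≤-refl)))

  shrink : ∀ {D ε} → 0ℚ ℚ.< D → 0ℚ ℚ.< ε → ∃ λ δ → 0ℚ ℚ.< δ × D ℚ.* δ ≡ ε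
  shrink {D} {ε} 0<D 0<ε = 1/D ℚ.* ε
    , subst (ℚ._< 1/D ℚ.* ε) (ℚ.*-zeroʳ 1/D)
        (ℚ.*-monoʳ-<-pos 1/D {{ℚ.1/pos⇒pos D {{D-pos}}}} 0<ε)
    , trans (sym (ℚ.*-assoc D 1/D ε))
        (trans (cong (ℚ._* ε) (ℚ.*-inverseʳ D {{D-nz}})) (ℚ.*-identityˡ ε))
    where
    D-pos = ℚ.positive 0<D
    D-nz  = ℚ.pos⇒nonZero D {{D-pos}}
    1/D   = ℚ.1/_ D {{D-nz}}

  ∣u*v∣< : ∀ u v {B δ} → 0ℚ ℚ.< B → ℚ.∣ u ∣ ℚ.≤ B → ℚ.∣ v ∣ ℚ.< δ → ℚ.∣ u ℚ.* v ∣ ℚ.< B ℚ.* δ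
  ∣u*v∣< u v {B} {δ} 0<B u≤ v< = let open ℚ.≤-Reasoning in begin-strict
    ℚ.∣ u ℚ.* v ∣       ≡⟨ ℚ.∣p*q∣≡∣p∣*∣q∣ u v ⟩
    ℚ.∣ u ∣ ℚ.* ℚ.∣ v ∣  ≤⟨ ℚ.*-monoʳ-≤-nonNeg ℚ.∣ v ∣ {{ℚ.∣-∣-nonNeg v}} u≤ ⟩
    B ℚ.* ℚ.∣ v ∣       <⟨ ℚ.*-monoʳ-<-pos B {{ℚ.positive 0<B}} v< ⟩
    B ℚ.* δ             ∎

  *-close : ∀ a b c d {B C δ ε} → 0ℚ ℚ.< B → 0ℚ ℚ.< C → (B ℚ.+ C) ℚ.* δ ≡ ε →
            ℚ.∣ a ∣ ℚ.≤ B → ℚ.∣ d ∣ ℚ.≤ C → ℚ.∣ b ℚ.- d ∣ ℚ.< δ → ℚ.∣ a ℚ.- c ∣ ℚ.< δ →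
            ℚ.∣ a ℚ.* b ℚ.- c ℚ.* d ∣ ℚ.< ε
  *-close a b c d {B} {C} {δ} {ε} 0<B 0<C eq a≤ d≤ b-d< a-c< =
    let open ℚ.≤-Reasoning in begin-strict
    ℚ.∣ a ℚ.* b ℚ.- c ℚ.* d ∣
      ≡⟨ cong ℚ.∣_∣ (lem a b c d) ⟩
    ℚ.∣ a ℚ.* (b ℚ.- d) ℚ.+ d ℚ.* (a ℚ.- c) ∣
      ≤⟨ ℚ.∣p+q∣≤∣p∣+∣q∣ (a ℚ.* (b ℚ.- d)) (d ℚ.* (a ℚ.- c)) ⟩
    ℚ.∣ a ℚ.* (b ℚ.- d) ∣ ℚ.+ ℚ.∣ d ℚ.* (a ℚ.- c) ∣
      <⟨ ℚ.+-mono-< (∣u*v∣< a (b ℚ.- d) 0<B a≤ b-d<) (∣u*v∣< d (a ℚ.- c) 0<C d≤ a-c<) ⟩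
    B ℚ.* δ ℚ.+ C ℚ.* δ
      ≡⟨ ℚ.*-distribʳ-+ δ B C ⟨
    (B ℚ.+ C) ℚ.* δ
      ≡⟨ eq ⟩
    ε ∎
    where
    lem : ∀ a b c d → a ℚ.* b ℚ.- c ℚ.* d ≡ a ℚ.* (b ℚ.- d) ℚ.+ d ℚ.* (a ℚ.- c)
    lem = solve 4 (λ a b c d → a :* b :- c :* d := a :* (b :- d) :+ d :* (a :- c)) refl

  *-cauchy : ∀ {x y} → IsCauchy x → IsCauchy y → IsCauchy (λ n → x n ℚ.* y n)
  *-cauchy {x} {y} cx cy ε 0<ε =
    let B , M₁ , 0<B , hB = bounded {x} cx
        C , N₁ , 0<C , hC = bounded {y} cy
        δ , 0<δ , eq      = shrink {B ℚ.+ C} (ℚ.+-mono-< 0<B 0<C) 0<ε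
        M₂ , hx           = cx δ 0<δ
        N₂ , hy           = cy δ 0<δ
        M                 = M₁ ℕ.⊔ M₂
        N                 = N₁ ℕ.⊔ N₂
        M≤ = λ {n} (h : M ℕ.⊔ N ℕ.≤ n) → ℕ.m⊔n≤o⇒m≤o M N h
        N≤ = λ {n} (h : M ℕ.⊔ N ℕ.≤ n) → ℕ.m⊔n≤o⇒n≤o M N h
    in M ℕ.⊔ N , λ m n m≥ n≥ →
      *-close (x m) (y m) (x n) (y n) 0<B 0<C eq
        (hB m (ℕ.m⊔n≤o⇒m≤o M₁ M₂ (M≤ m≥)))
        (hC n (ℕ.m⊔n≤o⇒m≤o N₁ N₂ (N≤ n≥)))
        (hy m n (ℕ.m⊔n≤o⇒n≤o N₁ N₂ (N≤ m≥)) (ℕ.m⊔n≤o⇒n≤o N₁ N₂ (N≤ n≥)))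
        (hx m n (ℕ.m⊔n≤o⇒n≤o M₁ M₂ (M≤ m≥)) (ℕ.m⊔n≤o⇒n≤o M₁ M₂ (M≤ n≥)))

infix  4 _≃ᴿ_ _<ᴿ_ _≤ᴿ_
infixl 6 _+ᴿ_ _-ᴿ_
infixl 7 _*ᴿ_
infixr 8 _^ᴿ_
infix  8 -ᴿ_

fromℚ : ℚ → ℝ
fromℚ q = mkℝ (λ _ → q) (const-cauchy q)

fromℕ : ℕ → ℝ
fromℕ n = fromℚ (+ n / 1)

_+ᴿ_ _*ᴿ_ : ℝ → ℝ → ℝ
x +ᴿ y = mkℝ (λ n → seq x n ℚ.+ seq y n) (+-cauchy {seq x} {seq y} (cauchy x) (cauchy y))
x *ᴿ y = mkℝ (λ n → seq x n ℚ.* seq y n) (*-cauchy {seq x} {seq y} (cauchy x) (cauchy y))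

-ᴿ_ ∣_∣ᴿ : ℝ → ℝ
-ᴿ x   = mkℝ (λ n → ℚ.- seq x n) (neg-cauchy {seq x} (cauchy x))
∣ x ∣ᴿ = mkℝ (λ n → ℚ.∣ seq x n ∣) (∣∣-cauchy {seq x} (cauchy x))

_-ᴿ_ : ℝ → ℝ → ℝ
x -ᴿ y = x +ᴿ (-ᴿ y)

_^ᴿ_ : ℝ → ℕ → ℝ
x ^ᴿ zero  = fromℕ 1
x ^ᴿ suc n = x *ᴿ x ^ᴿ n

_≃ᴿ_ _<ᴿ_ _≤ᴿ_ : ℝ → ℝ → Set
x ≃ᴿ y = ∀ ε → 0ℚ ℚ.< ε →
  ∃ λ N → ∀ n → N ℕ.≤ n → ℚ.∣ seq x n ℚ.- seq y n ∣ ℚ.< ε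
x <ᴿ y = ∃ λ δ → 0ℚ ℚ.< δ ×
  ∃ λ N → ∀ n → N ℕ.≤ n → seq x n ℚ.+ δ ℚ.≤ seq y n
x ≤ᴿ y = ∀ ε → 0ℚ ℚ.< ε →
  ∃ λ N → ∀ n → N ℕ.≤ n → seq x n ℚ.≤ seq y n ℚ.+ ε

infix 4 _⟶_

_⟶_ : (ℕ → ℝ) → ℝ → Set
x ⟶ L = ∀ ε → fromℕ 0 <ᴿ ε → ∃ λ N → ∀ n → N ℕ.≤ n → ∣ x n -ᴿ L ∣ᴿ <ᴿ ε

-- The n-th approximation of √ m is
-- ⌊ (n+1) √m ⌋ / (n+1).

floorSqrt : ∀ m → ∃ λ r → r ℕ.* r ℕ.≤ m × m ℕ.< suc r ℕ.* suc r
floorSqrt zero = 0 , z≤n , s≤s z≤n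
floorSqrt (suc m) with floorSqrt m
... | r , r²≤m , m<r² with suc r ℕ.* suc r ℕ.≤? suc m
...   | yes ≤m = suc r , ≤m ,
  ℕ.<-≤-trans (s≤s m<r²) (ℕ.*-mono-< {suc r} {suc (suc r)} {suc r} {suc (suc r)} ℕ.≤-refl ℕ.≤-refl)
...   | no  ≰m = r , ℕ.m≤n⇒m≤1+n r²≤m , ℕ.≰⇒> ≰m

√-seq : ℕ → ℕ → ℚ
√-seq m n = + proj₁ (floorSqrt (m ℕ.* (suc n ℕ.* suc n))) / suc n

private
  frac : ℕ → ℕ → ℚ
  frac p a = + p / suc a

  ↓frac : ∀ p a → toℚᵘ (frac p a) ℚᵘ.≃ mkℚᵘ (+ p) a
  ↓frac p a = ℚ.toℚᵘ-fromℚᵘ (mkℚᵘ (+ p) a)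

  frac-< : ∀ p a q b → p ℕ.* suc b ℕ.< q ℕ.* suc a → frac p a ℚ.< frac q b
  frac-< p a q b h = ℚ.toℚᵘ-cancel-<
    (ℚᵘ.<-respˡ-≃ (ℚᵘ.≃-sym (↓frac p a)) (ℚᵘ.<-respʳ-≃ (ℚᵘ.≃-sym (↓frac q b))
      (*<* (subst₂ ℤ._<_ (ℤ.pos-* p (suc b)) (ℤ.pos-* q (suc a)) (ℤ.+<+ h)))))

  frac-≤ : ∀ p a q b → p ℕ.* suc b ℕ.≤ q ℕ.* suc a → frac p a ℚ.≤ frac q b
  frac-≤ p a q b h = ℚ.toℚᵘ-cancel-≤
    (ℚᵘ.≤-respˡ-≃ (ℚᵘ.≃-sym (↓frac p a)) (ℚᵘ.≤-respʳ-≃ (ℚᵘ.≃-sym (↓frac q b))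
      (*≤* (subst₂ ℤ._≤_ (ℤ.pos-* p (suc b)) (ℤ.pos-* q (suc a)) (ℤ.+≤+ h)))))

  frac-≡ : ∀ p a q b → p ℕ.* suc b ≡ q ℕ.* suc a → frac p a ≡ frac q b
  frac-≡ p a q b h =
    ℚ.≤-antisym (frac-≤ p a q b (ℕ.≤-reflexive h)) (frac-≤ q b p a (ℕ.≤-reflexive (sym h)))

  frac-+ : ∀ p q a → frac p a ℚ.+ frac q a ≡ frac (p ℕ.+ q) a
  frac-+ p q a = ℚ.toℚᵘ-injective (ℚᵘ.≃-trans (ℚ.toℚᵘ-homo-+ (frac p a) (frac q a))
    (ℚᵘ.≃-trans (ℚᵘ.+-cong (↓frac p a) (↓frac q a))
    (ℚᵘ.≃-trans (*≡* (lem (+ p) (+ q) (+ suc a))) (ℚᵘ.≃-sym (↓frac (p ℕ.+ q) a)))))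
    where
    lem : ∀ x y z → (x ℤ.* z ℤ.+ y ℤ.* z) ℤ.* z ≡ (x ℤ.+ y) ℤ.* (z ℤ.* z)
    lem = ℤSolver.solve-∀

  frac-* : ∀ p a q b → frac p a ℚ.* frac q b ≡ frac (p ℕ.* q) (b ℕ.+ a ℕ.* suc b)
  frac-* p a q b = ℚ.toℚᵘ-injective (ℚᵘ.≃-trans (ℚ.toℚᵘ-homo-* (frac p a) (frac q b))
    (ℚᵘ.≃-trans (ℚᵘ.*-cong (↓frac p a) (↓frac q b))
    (ℚᵘ.≃-trans (*≡* (cong (ℤ._* (+ (suc a ℕ.* suc b))) (sym (ℤ.pos-* p q)))) (ℚᵘ.≃-sym (↓frac (p ℕ.* q) _)))))

  archimedean : ∀ p {ε} → 0ℚ ℚ.< ε → ∃ λ N → ∀ n → N ℕ.≤ n → frac p n ℚ.< ε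
  archimedean p {mkℚ (+ zero) d _} 0<ε = ⊥-elim (ℕ.<-irrefl refl (lem (ℚ.toℚᵘ-mono-< 0<ε)))
    where
    lem : ∀ {d} → mkℚᵘ (+ 0) 0 ℚᵘ.< mkℚᵘ (+ 0) d → 0 ℕ.< 0
    lem (*<* (ℤ.+<+ h)) = h
  archimedean p {mkℚ ℤ.-[1+ _ ] d _} (ℚ.*<* ())
  archimedean p {ε@(mkℚ (+ suc e) d _)} 0<ε = p ℕ.* suc d , λ n N≤n →
    subst (frac p n ℚ.<_) (ℚ.↥p/↧p≡p ε)
      (frac-< p n (suc e) d
        (ℕ.<-≤-trans (s≤s N≤n) (ℕ.m≤m+n (suc n) (e ℕ.* suc n))))

  square-< : ∀ {a b} → a ℕ.* a ℕ.< b ℕ.* b → a ℕ.< b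
  square-< {a} {b} h with a ℕ.<? b
  ... | yes a<b = a<b
  ... | no  a≮b = ⊥-elim (ℕ.<⇒≱ h (ℕ.*-mono-≤ (ℕ.≮⇒≥ a≮b) (ℕ.≮⇒≥ a≮b)))

  √-close : ∀ m a b → √-seq m a ℚ.- √-seq m b ℚ.< frac 1 b
  √-close m a b with floorSqrt (m ℕ.* (suc a ℕ.* suc a)) | floorSqrt (m ℕ.* (suc b ℕ.* suc b))
  ... | p , p²≤ , _ | q , _ , <q² =
    subst (frac p a ℚ.- frac q b ℚ.<_)
      (solve 2 (λ x y → (y :+ x) :- x := y) refl (frac q b) (frac 1 b))
      (ℚ.+-monoˡ-< (ℚ.- frac q b)
        (subst (frac p a ℚ.<_) (sym (frac-+ 1 q b)) (frac-< p a (suc q) b (square-< lem))))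
    where
    A′ = suc a
    B′ = suc b
    lem : (p ℕ.* B′) ℕ.* (p ℕ.* B′) ℕ.< (suc q ℕ.* A′) ℕ.* (suc q ℕ.* A′)
    lem = let open ℕ.≤-Reasoning in begin-strict
      (p ℕ.* B′) ℕ.* (p ℕ.* B′)             ≡⟨ sq p B′ ⟩
      (p ℕ.* p) ℕ.* (B′ ℕ.* B′)             ≤⟨ ℕ.*-monoˡ-≤ (B′ ℕ.* B′) p²≤ ⟩
      m ℕ.* (A′ ℕ.* A′) ℕ.* (B′ ℕ.* B′)     ≡⟨ sw m (A′ ℕ.* A′) (B′ ℕ.* B′) ⟩
      m ℕ.* (B′ ℕ.* B′) ℕ.* (A′ ℕ.* A′)     <⟨ ℕ.*-monoˡ-< (A′ ℕ.* A′) <q² ⟩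
      (suc q ℕ.* suc q) ℕ.* (A′ ℕ.* A′)     ≡⟨ sym (sq (suc q) A′) ⟩
      (suc q ℕ.* A′) ℕ.* (suc q ℕ.* A′)     ∎
      where
      sq : ∀ x y → (x ℕ.* y) ℕ.* (x ℕ.* y) ≡ (x ℕ.* x) ℕ.* (y ℕ.* y)
      sq = ℕSolver.solve-∀
      sw : ∀ x y z → x ℕ.* y ℕ.* z ≡ x ℕ.* z ℕ.* y
      sw = ℕSolver.solve-∀

  √-cauchy : ∀ m → IsCauchy (√-seq m)
  √-cauchy m ε 0<ε with archimedean 1 0<ε
  ... | N , h = N , λ a b a≥ b≥ → ∣p-q∣< (√-seq m a) (√-seq m b)
    (ℚ.<-trans (√-close m a b) (h b b≥)) (ℚ.<-trans (√-close m b a) (h a a≥))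

√ : ℕ → ℝ
√ m = mkℝ (√-seq m) (√-cauchy m)

√-nonNeg : ∀ m → fromℕ 0 ≤ᴿ √ m
√-nonNeg m ε 0<ε = 0 , λ n _ →
  ℚ.+-mono-≤ (frac-≤ 0 0 (proj₁ (floorSqrt (m ℕ.* (suc n ℕ.* suc n)))) n z≤n) (ℚ.<⇒≤ 0<ε)

√-square : ∀ m → √ m *ᴿ √ m ≃ᴿ fromℕ m
√-square m ε 0<ε with archimedean (2 ℕ.* m ℕ.+ 1) 0<ε
... | N , h = N , λ n n≥ → ∣p-q∣< (√-seq m n ℚ.* √-seq m n) (frac m 0)
      (ℚ.≤-<-trans (ub n) 0<ε)
      (ℚ.≤-<-trans (lb n) (h n n≥))
  where
  cancel : ∀ x y → x ℚ.≤ y → x ℚ.- y ℚ.≤ 0ℚ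
  cancel x y h = subst (x ℚ.- y ℚ.≤_) (ℚ.+-inverseʳ y) (ℚ.+-monoˡ-≤ (ℚ.- y) h)

  ub : ∀ n → √-seq m n ℚ.* √-seq m n ℚ.- frac m 0 ℚ.≤ 0ℚ
  ub n with floorSqrt (m ℕ.* (suc n ℕ.* suc n))
  ... | p , p²≤ , _ = cancel _ _ (subst (ℚ._≤ frac m 0) (sym (frac-* p n p n))
    (frac-≤ (p ℕ.* p) (n ℕ.+ n ℕ.* suc n) m 0
      (subst (ℕ._≤ m ℕ.* (suc n ℕ.* suc n)) (sym (ℕ.*-identityʳ (p ℕ.* p))) p²≤)))

  lb : ∀ n → frac m 0 ℚ.- √-seq m n ℚ.* √-seq m n ℚ.≤ frac (2 ℕ.* m ℕ.+ 1) n
  lb n with floorSqrt (m ℕ.* (suc n ℕ.* suc n))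
  ... | p , p²≤ , <p² = subst₂ ℚ._≤_
      (cong (λ z → frac m 0 ℚ.- z) (sym (frac-* p n p n)))
      (solve 2 (λ x y → (x :+ y) :- x := y) refl (frac (p ℕ.* p) D) (frac ((2 ℕ.* m ℕ.+ 1) ℕ.* suc n) D))
      (ℚ.+-monoˡ-≤ (ℚ.- frac (p ℕ.* p) D) main′)
    |> subst (frac m 0 ℚ.- frac p n ℚ.* frac p n ℚ.≤_)
         (frac-≡ ((2 ℕ.* m ℕ.+ 1) ℕ.* suc n) D (2 ℕ.* m ℕ.+ 1) n
           (ℕ.*-assoc (2 ℕ.* m ℕ.+ 1) (suc n) (suc n)))
    where
    D = n ℕ.+ n ℕ.* suc n
    K = suc n
    p≤ : p ℕ.≤ m ℕ.* K
    p≤ = ℕ.≮⇒≥ λ mK<p → ℕ.<⇒≱ (ℕ.*-mono-< mK<p mK<p) (ℕ.≤-trans p²≤ lem₀)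
      where
      lem₀ : m ℕ.* (K ℕ.* K) ℕ.≤ (m ℕ.* K) ℕ.* (m ℕ.* K)
      lem₀ = begin
        m ℕ.* (K ℕ.* K)             ≤⟨ ℕ.*-monoˡ-≤ (K ℕ.* K) (m≤m² m) ⟩
        (m ℕ.* m) ℕ.* (K ℕ.* K)     ≡⟨ sq m K ⟩
        (m ℕ.* K) ℕ.* (m ℕ.* K)     ∎
        where
        open ℕ.≤-Reasoning
        m≤m² : ∀ m → m ℕ.≤ m ℕ.* m
        m≤m² zero    = z≤n
        m≤m² (suc m) = ℕ.m≤m*n (suc m) (suc m)
        sq : ∀ x y → (x ℕ.* x) ℕ.* (y ℕ.* y) ≡ (x ℕ.* y) ℕ.* (x ℕ.* y)
        sq = ℕSolver.solve-∀
    nat : m ℕ.* (K ℕ.* K) ℕ.≤ p ℕ.* p ℕ.+ (2 ℕ.* m ℕ.+ 1) ℕ.* K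
    nat = begin
      m ℕ.* (K ℕ.* K)                          ≤⟨ ℕ.<⇒≤ <p² ⟩
      suc p ℕ.* suc p                          ≡⟨ e₁ p ⟩
      p ℕ.* p ℕ.+ (2 ℕ.* p ℕ.+ 1)
        ≤⟨ ℕ.+-monoʳ-≤ (p ℕ.* p) (ℕ.+-mono-≤ (ℕ.*-monoʳ-≤ 2 p≤) (s≤s (z≤n {n}))) ⟩
      p ℕ.* p ℕ.+ (2 ℕ.* (m ℕ.* K) ℕ.+ K)      ≡⟨ cong (p ℕ.* p ℕ.+_) (e₂ m K) ⟩
      p ℕ.* p ℕ.+ (2 ℕ.* m ℕ.+ 1) ℕ.* K        ∎
      where
      open ℕ.≤-Reasoning
      e₁ : ∀ p → suc p ℕ.* suc p ≡ p ℕ.* p ℕ.+ (2 ℕ.* p ℕ.+ 1)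
      e₁ = ℕSolver.solve-∀
      e₂ : ∀ m k → 2 ℕ.* (m ℕ.* k) ℕ.+ k ≡ (2 ℕ.* m ℕ.+ 1) ℕ.* k
      e₂ = ℕSolver.solve-∀
    main′ : frac m 0 ℚ.≤ frac (p ℕ.* p) D ℚ.+ frac ((2 ℕ.* m ℕ.+ 1) ℕ.* suc n) D
    main′ = subst (frac m 0 ℚ.≤_) (sym (frac-+ (p ℕ.* p) ((2 ℕ.* m ℕ.+ 1) ℕ.* suc n) D))
      (frac-≤ m 0 (p ℕ.* p ℕ.+ (2 ℕ.* m ℕ.+ 1) ℕ.* suc n) D
        (subst (m ℕ.* (K ℕ.* K) ℕ.≤_) (sym (ℕ.*-identityʳ _)) nat))

{-# OPTIONS --safe #-}

-- Collapsing the l consecutive values {k,…,k+l−1}, which stand in consecutive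
-- positions, to one point gives a bijection from A^(n)_{l;k} ∩ S_n^sep to
-- S_{n−l+1}^sep × S_l^sep, so with s_n = |S_n^sep| the probability equals
-- s_l s_{n−l+1} / s_n, whatever k is.  It remains to show that
-- s_n / s_{n+1} → 3 − 2√2.
--
-- Splitting off the first ⊕-indecomposable summand, and reversing, shows that
-- S = Σ s_n xⁿ satisfies S = x + S² + x S, which gives the recurrence
-- (n+2) s_{n+2} = (6n+3) s_{n+1} − (n−1) s_n.  Hence
-- F_n = 6 s_n s_{n+1} − s_n² − s_{n+1}² satisfies
-- (n+2) (F_{n+1} − F_n) = (9 s_{n+1} − 3 s_n) (s_{n+2} − s_n),
-- and since s at least triples this yields 0 ≤ F_n ≤ 4 s_{n+1}² / (n+1): the
-- ratio x = s_n / s_{n+1} is an approximate root of x² − 6x + 1.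

module Submission where

open import Data.List using (length)
open import Data.Nat using (ℕ; _≤_; _<_; _+_; _∸_)
open import Data.Product using (_×_)
open import Defs

open import Algebra using (CommutativeSemiring)
import Algebra.Construct.Pointwise as Pointwise
import Algebra.Solver.Ring.NaturalCoefficients.Default as SemiringSolver
open import Algebra.Structures.Biased using (isCommutativeMonoidˡ; isCommutativeSemiringˡ)
import Data.Integer as ℤ
import Data.Integer.Properties as ℤ
open import Data.List as List
  using (List; []; _∷_; [_]; _++_; map; concatMap; filter; take; drop; applyUpTo; cartesianProduct; reverse)
import Data.List.Properties as List
open import Data.List.Membership.Propositional using (_∈_; _∉_; find)
open import Data.List.Membership.Propositional.Properties
open import Data.List.Membership.Propositional.Properties.WithK using (unique∧set⇒bag)
open import Data.List.Relation.Binary.BagAndSetEquality using (∼bag⇒↭)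
open import Data.List.Relation.Binary.Permutation.Propositional as Perm
  using (_↭_; prep; ↭-refl; ↭-sym; ↭-trans; ↭-reflexive)
import Data.List.Relation.Binary.Permutation.Propositional.Properties as ↭
import Data.List.Relation.Binary.Permutation.Setoid.Properties as ↭ₛ
open import Data.List.Relation.Unary.All as All using (All; []; _∷_)
open import Data.List.Relation.Unary.AllPairs using ([]; _∷_)
open import Data.List.Relation.Unary.Any using (here; there)
open import Data.List.Relation.Unary.Unique.Propositional using (Unique)
import Data.List.Relation.Unary.Unique.Propositional.Properties as Unique
open import Data.Nat as ℕ using (zero; suc; _*_; _⊓_; z≤n; s≤s; _≤?_; _<?_; NonZero)
open import Data.Nat.Properties
open import Data.Nat.Tactic.RingSolver using (solve-∀)
open import Data.Product using (∃; ∃₂; _,_; proj₁; proj₂)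
open import Data.Rational as ℚ using (ℚ; 0ℚ; 1ℚ; ½; _/_; toℚᵘ)
import Data.Rational.Properties as ℚ
open import Data.Rational.Solver using (module +-*-Solver)
open import Data.Rational.Unnormalised as ℚᵘ using (mkℚᵘ; *≤*; *<*; *≡*)
import Data.Rational.Unnormalised.Properties as ℚᵘ
open import Data.Sum using (_⊎_; inj₁; inj₂)
open import Function using (_∘_; mk⇔; Equivalence)
open import Level using (0ℓ)
open import Relation.Binary.Definitions using (tri<; tri≈; tri>)
open import Relation.Binary.PropositionalEquality
  using (_≡_; _≢_; _≗_; refl; sym; trans; cong; cong₂; subst; subst₂; setoid; isEquivalence)
open import Relation.Nullary using (¬_; yes; no; contradiction)
open import Relation.Nullary.Decidable using (from-yes)
open import Relation.Unary using (Pred; Decidable)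
open import Relation.Unary.Properties using (∁?)

-- No asymptotic formula for s_n is needed, only the limit of the ratio of neighbours, because
-- s_{n-l+1} / s_n is a product of l - 1 such ratios. As n grows the recurrence tends to s_{n+2} = 6
-- s_{n+1} - s_n, and F_n is the quadratic form which that limiting recurrence preserves: F_{n+1} -
-- F_n = (s_{n+2} - s_n) (6 s_{n+1} - s_{n+2} - s_n). The true recurrence therefore changes F_n only
-- by terms of order s²/n. Monotonicity of s then selects the smaller root of x² - 6x + 1. The
-- counting stays in ℕ, so each difference is either moved across the equation or named as a natural
-- number of its own. On the permutation side the obstacle is that a separable permutation has many
-- derivations from direct and skew sums. Comparing its first entry with its last decides which kind
-- of sum it is without looking at a derivation, and this makes the decomposition unique.

-- Formal power series over ℕ; θ is the derivation x d/dx.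

Seq : Set
Seq = ℕ → ℕ

infixl 6 _⊞_
infixl 7 _⊛_

𝟎 𝟏 𝐱 : Seq
𝟎 _ = 0
𝟏 zero    = 1
𝟏 (suc _) = 0
𝐱 zero    = 0
𝐱 (suc n) = 𝟏 n

-- `_⊛_` is the Cauchy product, by f g = f(0) g + x f′ g with f′ the shift `f ∘ suc`; no sums over
-- indices appear.
_⊞_ _⊛_ : Seq → Seq → Seq
(f ⊞ g) n = f n + g n
(f ⊛ g) zero    = f 0 * g 0
(f ⊛ g) (suc n) = f 0 * g (suc n) + (f ∘ suc ⊛ g) n

θ : Seq → Seq
θ f n = n * f n

⊛-cong : ∀ {f f′ g g′} → f ≗ f′ → g ≗ g′ → f ⊛ g ≗ f′ ⊛ g′
⊛-cong p q zero    = cong₂ _*_ (p 0) (q 0)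
⊛-cong p q (suc n) = cong₂ _+_ (cong₂ _*_ (p 0) (q (suc n))) (⊛-cong (p ∘ suc) q n)

⊛-zeroˡ : ∀ f → 𝟎 ⊛ f ≗ 𝟎
⊛-zeroˡ f zero    = refl
⊛-zeroˡ f (suc n) = ⊛-zeroˡ f n

⊛-identityˡ : ∀ f → 𝟏 ⊛ f ≗ f
⊛-identityˡ f zero    = +-identityʳ (f 0)
⊛-identityˡ f (suc n) =
  trans (cong₂ _+_ (+-identityʳ (f (suc n))) (⊛-zeroˡ f n)) (+-identityʳ (f (suc n)))

⊛-distribʳ : ∀ h f g → (f ⊞ g) ⊛ h ≗ (f ⊛ h) ⊞ (g ⊛ h)
⊛-distribʳ h f g zero    = *-distribʳ-+ (h 0) (f 0) (g 0)
⊛-distribʳ h f g (suc n) = trans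
  (cong ((f 0 + g 0) * h (suc n) +_) (⊛-distribʳ h (f ∘ suc) (g ∘ suc) n))
  (arith (f 0) (g 0) (h (suc n)) _ _)
  where
  arith : ∀ a b c u v → (a + b) * c + (u + v) ≡ (a * c + u) + (b * c + v)
  arith = solve-∀

⊛-scaleˡ : ∀ c f g → (λ n → c * f n) ⊛ g ≗ (λ n → c * (f ⊛ g) n)
⊛-scaleˡ c f g zero    = *-assoc c (f 0) (g 0)
⊛-scaleˡ c f g (suc n) = trans
  (cong (c * f 0 * g (suc n) +_) (⊛-scaleˡ c (f ∘ suc) g n))
  (arith c (f 0) (g (suc n)) _)
  where
  arith : ∀ c a b u → c * a * b + c * u ≡ c * (a * b + u)
  arith = solve-∀

-- The mirror image of the defining clause, peeling off `g 0` instead of `f 0`; commutativity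
-- follows by matching the two.
⊛-sucʳ : ∀ f g n → (f ⊛ g) (suc n) ≡ (f ⊛ (g ∘ suc)) n + f (suc n) * g 0
⊛-sucʳ f g zero    = refl
⊛-sucʳ f g (suc n) = trans (cong (f 0 * g (2 + n) +_) (⊛-sucʳ (f ∘ suc) g n))
  (sym (+-assoc (f 0 * g (2 + n)) _ _))

⊛-comm : ∀ f g → f ⊛ g ≗ g ⊛ f
⊛-comm f g zero    = *-comm (f 0) (g 0)
⊛-comm f g (suc n) = trans
  (cong₂ _+_ (*-comm (f 0) (g (suc n))) (⊛-comm (f ∘ suc) g n))
  (trans (+-comm (g (suc n) * f 0) _) (sym (⊛-sucʳ g f n)))

⊛-assoc : ∀ f g h → (f ⊛ g) ⊛ h ≗ f ⊛ (g ⊛ h)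
⊛-assoc f g h zero    = *-assoc (f 0) (g 0) (h 0)
⊛-assoc f g h (suc n) = trans
  (cong (f 0 * g 0 * h (suc n) +_)
    (trans (⊛-distribʳ h (λ m → f 0 * g (suc m)) (f ∘ suc ⊛ g) n)
           (cong₂ _+_ (⊛-scaleˡ (f 0) (g ∘ suc) h n) (⊛-assoc (f ∘ suc) g h n))))
  (arith (f 0) (g 0) (h (suc n)) _ _)
  where
  arith : ∀ a b c u v → a * b * c + (a * u + v) ≡ a * (b * c + u) + v
  arith = solve-∀

𝐱⊛ : ∀ f n → (𝐱 ⊛ f) (suc n) ≡ f n
𝐱⊛ f n = ⊛-identityˡ f n

θ-⊞ : ∀ f g → θ (f ⊞ g) ≗ θ f ⊞ θ g
θ-⊞ f g n = *-distribˡ-+ n (f n) (g n)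

θ-𝐱 : θ 𝐱 ≗ 𝐱
θ-𝐱 zero          = refl
θ-𝐱 (suc zero)    = refl
θ-𝐱 (suc (suc n)) = *-zeroʳ n

θ-⊛ : ∀ f g → θ (f ⊛ g) ≗ (θ f ⊛ g) ⊞ (f ⊛ θ g)
θ-⊛ f g zero    = sym (*-zeroʳ (f 0))
θ-⊛ f g (suc n) = trans (arith₁ n (f 0) (g (suc n)) ((f ∘ suc ⊛ g) n))
  (trans (cong (λ t → f 0 * (suc n * g (suc n)) + ((f ∘ suc ⊛ g) n + t)) (θ-⊛ (f ∘ suc) g n))
  (trans (arith₂ (f 0 * (suc n * g (suc n))) ((f ∘ suc ⊛ g) n) ((θ (f ∘ suc) ⊛ g) n) ((f ∘ suc ⊛ θ g) n))
    (cong (_+ (f 0 * (suc n * g (suc n)) + (f ∘ suc ⊛ θ g) n))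
          -- `θ f ∘ suc` unfolds to `f ∘ suc ⊞ θ (f ∘ suc)`, and the term with `θ f 0` vanishes.
          (sym (⊛-distribʳ g (f ∘ suc) (θ (f ∘ suc)) n)))))
  where
  arith₁ : ∀ n a b u → suc n * (a * b + u) ≡ a * (suc n * b) + (u + n * u)
  arith₁ = solve-∀
  arith₂ : ∀ a u v w → a + (u + (v + w)) ≡ (u + v) + (a + w)
  arith₂ = solve-∀

-- Packaged for the semiring solver, which checks `certificate` below.
seqSemiring : CommutativeSemiring 0ℓ 0ℓ
seqSemiring = record
  { Carrier = Seq
  ; _≈_     = _≗_
  ; _+_     = _⊞_
  ; _*_     = _⊛_
  ; 0#      = 𝟎
  ; 1#      = 𝟏
  ; isCommutativeSemiring = isCommutativeSemiringˡ record
    { +-isCommutativeMonoid = Pointwise.isCommutativeMonoid ℕ +-0-isCommutativeMonoid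
    ; *-isCommutativeMonoid = isCommutativeMonoidˡ record
      { isSemigroup = record
        { isMagma = record
          { isEquivalence = Pointwise.isEquivalence ℕ isEquivalence
          ; ∙-cong        = ⊛-cong
          }
        ; assoc = ⊛-assoc
        }
      ; identityˡ = ⊛-identityˡ
      ; comm      = ⊛-comm
      }
    ; distribʳ = ⊛-distribʳ
    ; zeroˡ    = ⊛-zeroˡ
    }
  }

-- The differential equation and the recurrence for the counts.

-- With T = 1 − x − 2 S, the equation gives T² = 1 − 6 x + x² and
-- T θ S = x (1 + S), hence (1 − 6 x + x²) θ S = x (1 + x) + (x² − 3 x) S; here
-- every term is moved to the side where its sign is positive.

schröder-differential : ∀ S → S ≗ 𝐱 ⊞ S ⊛ S ⊞ 𝐱 ⊛ S →
  let u = 𝐱 ⊛ θ S in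
  θ S ⊞ 𝐱 ⊛ u ⊞ (𝐱 ⊛ S ⊞ 𝐱 ⊛ S ⊞ 𝐱 ⊛ S) ≗
  (u ⊞ u ⊞ u ⊞ u ⊞ u ⊞ u) ⊞ 𝐱 ⊞ 𝐱 ⊛ 𝐱 ⊞ 𝐱 ⊛ (𝐱 ⊛ S)
-- Without subtraction, a combination of the hypotheses is added as `side S Θ b₁ b₂` on one side and
-- as `side b₁ b₂ S Θ` on the other. The two agree because `S ≗ b₁` and `Θ ≗ b₂`, so they cancel.
schröder-differential S eq n = +-cancelʳ-≡ (side S Θ b₁ b₂ n) _ _
  (trans (certificate n) (cong (right n +_) (sides n)))
  where
  Θ  = θ S
  b₁ = 𝐱 ⊞ S ⊛ S ⊞ 𝐱 ⊛ S
  b₂ = 𝐱 ⊞ (Θ ⊛ S ⊞ S ⊛ Θ) ⊞ (𝐱 ⊛ S ⊞ 𝐱 ⊛ Θ)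

  right = let u = 𝐱 ⊛ Θ in (u ⊞ u ⊞ u ⊞ u ⊞ u ⊞ u) ⊞ 𝐱 ⊞ 𝐱 ⊛ 𝐱 ⊞ 𝐱 ⊛ (𝐱 ⊛ S)

  eq′ : Θ ≗ b₂
  eq′ n = trans (cong (n *_) (eq n))
    (trans (θ-⊞ (𝐱 ⊞ S ⊛ S) (𝐱 ⊛ S) n)
    (cong₂ _+_ (trans (θ-⊞ 𝐱 (S ⊛ S) n) (cong₂ _+_ (θ-𝐱 n) (θ-⊛ S S n)))
      (trans (θ-⊛ 𝐱 S n) (cong (_+ (𝐱 ⊛ Θ) n) (⊛-cong {θ 𝐱} {𝐱} {S} {S} θ-𝐱 (λ _ → refl) n)))))

  open SemiringSolver seqSemiring using (solve; _:+_; _:*_; _:=_)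

  -- The difference of the two sides of the claim is
  -- T (θ S − b₂) + 4 (S − b₁) θ S + 2 x (S − b₁).
  side : Seq → Seq → Seq → Seq → Seq
  side p₁ p₂ q₁ q₂ = q₂ ⊞ (𝐱 ⊞ S ⊞ S) ⊛ p₂ ⊞ (q₁ ⊞ q₁ ⊞ q₁ ⊞ q₁) ⊛ Θ ⊞ 𝐱 ⊛ (q₁ ⊞ q₁)

  sides : side b₁ b₂ S Θ ≗ side S Θ b₁ b₂
  sides n = cong₂ _+_ (cong₂ _+_ (cong₂ _+_ (eq′ n)
    (⊛-cong {𝐱 ⊞ S ⊞ S} {𝐱 ⊞ S ⊞ S} (λ _ → refl) (λ n → sym (eq′ n)) n))
    (⊛-cong {g = Θ} {Θ} (λ n → cong₂ _+_ (cong₂ _+_ (cong₂ _+_ (eq n) (eq n)) (eq n)) (eq n)) (λ _ → refl) n))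
    (⊛-cong {𝐱} {𝐱} (λ _ → refl) (λ n → cong₂ _+_ (eq n) (eq n)) n)

  certificate :
    (Θ ⊞ 𝐱 ⊛ (𝐱 ⊛ Θ) ⊞ (𝐱 ⊛ S ⊞ 𝐱 ⊛ S ⊞ 𝐱 ⊛ S)) ⊞ side S Θ b₁ b₂ ≗
    right ⊞ side b₁ b₂ S Θ
  certificate = solve 3 (λ x s t →
    let c₁ = x :+ s :* s :+ x :* s
        c₂ = x :+ (t :* s :+ s :* t) :+ (x :* s :+ x :* t)
        sd = λ p₁ p₂ q₁ q₂ → q₂ :+ (x :+ s :+ s) :* p₂ :+ (q₁ :+ q₁ :+ q₁ :+ q₁) :* t :+ x :* (q₁ :+ q₁)
        u  = x :* t
    in (t :+ x :* u :+ (x :* s :+ x :* s :+ x :* s)) :+ sd s t c₁ c₂ :=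
       (u :+ u :+ u :+ u :+ u :+ u) :+ x :+ x :* x :+ x :* (x :* s) :+ sd c₁ c₂ s t)
    (λ _ → refl) 𝐱 S Θ

-- The coefficient at exponent 3 + n, where x and x² no longer contribute. The cancelled
-- `S (1 + n) + 3 * S (2 + n)` turns the factors 1 + n and 6 (2 + n) into n and 9 + 6 n.
schröder-recurrence : ∀ S → S ≗ 𝐱 ⊞ S ⊛ S ⊞ 𝐱 ⊛ S → ∀ n →
  (3 + n) * S (3 + n) + n * S (1 + n) ≡ (9 + 6 * n) * S (2 + n)
schröder-recurrence S eq n = +-cancelʳ-≡ (S (1 + n) + 3 * S (2 + n)) _ _
  (trans (arith₁ n (S (1 + n)) (S (2 + n)) (S (3 + n)))
  (trans lhs (trans (schröder-differential S eq (3 + n)) (trans rhs (arith₂ n (S (1 + n)) (S (2 + n)))))))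
  where
  u = 𝐱 ⊛ θ S
  arith₁ : ∀ n a b c → (3 + n) * c + n * a + (a + 3 * b) ≡ (3 + n) * c + (1 + n) * a + (b + b + b)
  arith₁ = solve-∀
  arith₂ : ∀ n a b → (2 + n) * b + (2 + n) * b + (2 + n) * b + (2 + n) * b + (2 + n) * b + (2 + n) * b + 0 + 0 + a ≡
                     (9 + 6 * n) * b + (a + 3 * b)
  arith₂ = solve-∀
  lhs : (3 + n) * S (3 + n) + (1 + n) * S (1 + n) + (S (2 + n) + S (2 + n) + S (2 + n)) ≡
        (θ S ⊞ 𝐱 ⊛ u ⊞ (𝐱 ⊛ S ⊞ 𝐱 ⊛ S ⊞ 𝐱 ⊛ S)) (3 + n)
  lhs = cong₂ (λ a b → (3 + n) * S (3 + n) + a + (b + b + b))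
    (sym (trans (𝐱⊛ u (2 + n)) (𝐱⊛ (θ S) (1 + n)))) (sym (𝐱⊛ S (2 + n)))
  rhs : ((u ⊞ u ⊞ u ⊞ u ⊞ u ⊞ u) ⊞ 𝐱 ⊞ 𝐱 ⊛ 𝐱 ⊞ 𝐱 ⊛ (𝐱 ⊛ S)) (3 + n) ≡
        (2 + n) * S (2 + n) + (2 + n) * S (2 + n) + (2 + n) * S (2 + n) + (2 + n) * S (2 + n)
        + (2 + n) * S (2 + n) + (2 + n) * S (2 + n) + 0 + 0 + S (1 + n)
  rhs = cong₂ _+_ (cong₂ (λ a b → a + a + a + a + a + a + 0 + b) (𝐱⊛ (θ S) (2 + n)) (𝐱⊛ 𝐱 (2 + n)))
    (trans (𝐱⊛ (𝐱 ⊛ S) (2 + n)) (𝐱⊛ S (1 + n)))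

-- Growth of the counts and the nearly invariant quadratic form.

-- Used for a = s_{n+1} and b = s_{n+2}; F is F_{n+1} of the header.
Near : ℕ → ℕ → ℕ → Set
Near n a b = a ≤ b × ∃ λ F → a * a + b * b + F ≡ 6 * a * b × (2 + n) * F ≤ 4 * (b * b)

-- Lets `near-step` write `c` as `3 * b + e` with a natural number `e`.
tripling : ∀ n a b c → (3 + n) * c + n * a ≡ (9 + 6 * n) * b → a ≤ b → 3 * b ≤ c
tripling n a b c rec a≤b = *-cancelˡ-≤ (3 + n) (+-cancelʳ-≤ (n * a) _ _ (begin
  (3 + n) * (3 * b) + n * a              ≤⟨ +-monoʳ-≤ ((3 + n) * (3 * b)) (*-monoʳ-≤ n a≤b) ⟩
  (3 + n) * (3 * b) + n * b              ≤⟨ m≤m+n _ (2 * n * b) ⟩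
  (3 + n) * (3 * b) + n * b + 2 * n * b  ≡⟨ arith n b ⟩
  (9 + 6 * n) * b                        ≡⟨ sym rec ⟩
  (3 + n) * c + n * a                    ∎))
  where
  open ≤-Reasoning
  arith : ∀ n b → (3 + n) * (3 * b) + n * b + 2 * n * b ≡ (9 + 6 * n) * b
  arith = solve-∀

-- With b = a + d and c = 3 b + e all terms are positive: the next F is
-- 8 b² − e², and t = 2 a + 3 d gives (n + 3) (F′ − F) = 3 t (t + e).
near-step′ : ∀ n a d e F → (3 + n) * e ≡ n * (2 * a + 3 * d) →
  d * d + F ≡ 4 * a * (a + d) → (2 + n) * F ≤ 4 * ((a + d) * (a + d)) →
  ∃ λ F′ → e * e + F′ ≡ 8 * ((a + d) * (a + d)) ×
           (3 + n) * F′ ≤ 4 * ((3 * (a + d) + e) * (3 * (a + d) + e))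
near-step′ n a d e F rec eq F≤ = F′ , m+[n∸m]≡n e²≤ , (begin
  (3 + n) * F′                          ≡⟨ F′≡ ⟩
  (3 + n) * F + Δ                       ≤⟨ +-monoˡ-≤ Δ (begin
    -- Doubling the old bound is affordable, since the right-hand side grows at least ninefold when
    -- `b` triples.
    (3 + n) * F                         ≤⟨ m≤m+n _ ((1 + n) * F) ⟩
    (3 + n) * F + (1 + n) * F           ≡⟨ arith₃ n F ⟩
    2 * ((2 + n) * F)                   ≤⟨ *-monoʳ-≤ 2 F≤ ⟩
    2 * (4 * ((a + d) * (a + d)))       ∎) ⟩
  2 * (4 * ((a + d) * (a + d))) + Δ     ≤⟨ m≤m+n _ _ ⟩
  -- The last summand is the exact slack, a polynomial with positive coefficients.
  2 * (4 * ((a + d) * (a + d))) + Δ + (16 * a * a + 20 * a * d + d * d + 18 * a * e + 15 * d * e + 4 * e * e)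
    ≡⟨ arith₄ a d e ⟩
  4 * ((3 * (a + d) + e) * (3 * (a + d) + e)) ∎)
  where
  open ≤-Reasoning
  t  = 2 * a + 3 * d
  Δ  = 3 * t * (t + e)
  F′ = 8 * ((a + d) * (a + d)) ∸ e * e

  arith₁ : ∀ n t e F → (3 + n) * (e * e) + ((3 + n) * F + 3 * t * (t + e)) ≡
                       e * ((3 + n) * e) + 3 * t * e + (3 * (t * t) + (3 + n) * F)
  arith₁ = solve-∀
  arith₁′ : ∀ n t e F → e * (n * t) + 3 * t * e + (3 * (t * t) + (3 + n) * F) ≡
                        t * ((3 + n) * e) + (3 * (t * t) + (3 + n) * F)
  arith₁′ = solve-∀
  arith₂ : ∀ n a d F → (2 * a + 3 * d) * (n * (2 * a + 3 * d)) + (3 * ((2 * a + 3 * d) * (2 * a + 3 * d)) + (3 + n) * F) ≡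
                       (3 + n) * (4 * a * a + 12 * a * d + 8 * d * d + (d * d + F))
  arith₂ = solve-∀
  arith₂′ : ∀ n a d → (3 + n) * (4 * a * a + 12 * a * d + 8 * d * d + 4 * a * (a + d)) ≡
                      (3 + n) * (8 * ((a + d) * (a + d)))
  arith₂′ = solve-∀
  arith₃ : ∀ n F → (3 + n) * F + (1 + n) * F ≡ 2 * ((2 + n) * F)
  arith₃ = solve-∀
  arith₄ : ∀ a d e → 2 * (4 * ((a + d) * (a + d))) + 3 * (2 * a + 3 * d) * ((2 * a + 3 * d) + e)
    + (16 * a * a + 20 * a * d + d * d + 18 * a * e + 15 * d * e + 4 * e * e) ≡
    4 * ((3 * (a + d) + e) * (3 * (a + d) + e))
  arith₄ = solve-∀

  -- Serves twice: it shows that the truncated subtraction in `F′` is exact, and it gives the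
  -- increment `Δ` of the form, scaled by 3 + n.
  key : (3 + n) * (e * e) + ((3 + n) * F + Δ) ≡ (3 + n) * (8 * ((a + d) * (a + d)))
  key = trans (arith₁ n t e F)
    (trans (cong (λ z → e * z + 3 * t * e + (3 * (t * t) + (3 + n) * F)) rec)
    (trans (arith₁′ n t e F)
    (trans (cong (λ z → t * z + (3 * (t * t) + (3 + n) * F)) rec)
    (trans (arith₂ n a d F)
    (trans (cong (λ z → (3 + n) * (4 * a * a + 12 * a * d + 8 * d * d + z)) eq) (arith₂′ n a d))))))

  e²≤ : e * e ≤ 8 * ((a + d) * (a + d))
  e²≤ = *-cancelˡ-≤ (3 + n) (≤-trans (m≤m+n _ _) (≤-reflexive key))

  F′≡ : (3 + n) * F′ ≡ (3 + n) * F + Δ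
  F′≡ = +-cancelˡ-≡ ((3 + n) * (e * e)) _ _ (trans (sym (*-distribˡ-+ (3 + n) (e * e) F′))
    (trans (cong ((3 + n) *_) (m+[n∸m]≡n e²≤)) (sym key)))

near-step : ∀ n a b c → (3 + n) * c + n * a ≡ (9 + 6 * n) * b → Near n a b → Near (suc n) b c
near-step n a b c rec (a≤b , F , eq , F≤) with m≤n⇒∃[o]m+o≡n a≤b | m≤n⇒∃[o]m+o≡n (tripling n a b c rec a≤b)
... | d , refl | e , refl =
  ≤-trans (m≤m+n b (b + (b + 0))) (m≤m+n (3 * b) e) ,
  let F′ , eq′ , F′≤ = near-step′ n a d e F
        (+-cancelˡ-≡ ((9 + 3 * n) * b + n * a) _ _ (trans (arith₁ n a d e) (trans rec (arith₂ n a d))))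
        (+-cancelˡ-≡ (2 * a * a + 2 * a * d) _ _ (trans (arith₃ a d F) (trans eq (arith₄ a d)))) F≤
  in F′ , trans (arith₅ b e F′) (trans (cong (9 * b * b + b * b + 6 * b * e +_) eq′) (arith₆ b e)) , F′≤
  where
  arith₁ : ∀ n a d e → ((9 + 3 * n) * (a + d) + n * a) + (3 + n) * e ≡ (3 + n) * (3 * (a + d) + e) + n * a
  arith₁ = solve-∀
  arith₂ : ∀ n a d → (9 + 6 * n) * (a + d) ≡ ((9 + 3 * n) * (a + d) + n * a) + n * (2 * a + 3 * d)
  arith₂ = solve-∀
  arith₃ : ∀ a d F → (2 * a * a + 2 * a * d) + (d * d + F) ≡ a * a + (a + d) * (a + d) + F
  arith₃ = solve-∀
  arith₄ : ∀ a d → 6 * a * (a + d) ≡ (2 * a * a + 2 * a * d) + 4 * a * (a + d)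
  arith₄ = solve-∀
  arith₅ : ∀ b e F → b * b + (3 * b + e) * (3 * b + e) + F ≡ 9 * b * b + b * b + 6 * b * e + (e * e + F)
  arith₅ = solve-∀
  arith₆ : ∀ b e → 9 * b * b + b * b + 6 * b * e + 8 * (b * b) ≡ 6 * b * (3 * b + e)
  arith₆ = solve-∀

near : (w : ℕ → ℕ) → w 0 ≡ 1 → w 1 ≡ 2 →
       (∀ n → (3 + n) * w (2 + n) + n * w n ≡ (9 + 6 * n) * w (1 + n)) →
       ∀ n → Near n (w n) (w (1 + n))
-- For 1 and 2 the form is 12 - 1 - 4 = 7. The bound reads 14 ≤ 16 here, so 4 is the least integer
-- constant that the start of the induction allows.
near w w₀ w₁ rec zero    rewrite w₀ | w₁ = from-yes (1 ≤? 2) , 7 , refl , from-yes (14 ≤? 16)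
near w w₀ w₁ rec (suc n) = near-step n (w n) (w (1 + n)) (w (2 + n)) (rec n) (near w w₀ w₁ rec n)

-- Ratios of natural numbers as rationals.

open +-*-Solver using (solve; con; _:+_; _:*_; :-_; _:-_; _:=_)

ι : ℕ → ℚ
ι n = ℤ.+ n / 1

toℚᵘ-/ : ∀ p a → toℚᵘ (ℤ.+ p / suc a) ℚᵘ.≃ mkℚᵘ (ℤ.+ p) a
toℚᵘ-/ p a = ℚ.toℚᵘ-fromℚᵘ (mkℚᵘ (ℤ.+ p) a)

ι-+ : ∀ m n → ι (m + n) ≡ ι m ℚ.+ ι n
ι-+ m n = ℚ.toℚᵘ-injective (ℚᵘ.≃-trans (toℚᵘ-/ (m + n) 0) (ℚᵘ.≃-sym
  (ℚᵘ.≃-trans (ℚ.toℚᵘ-homo-+ (ι m) (ι n)) (ℚᵘ.≃-trans (ℚᵘ.+-cong (toℚᵘ-/ m 0) (toℚᵘ-/ n 0))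
    (*≡* (cong (ℤ._* ℤ.+ 1) (cong₂ ℤ._+_ (ℤ.*-identityʳ (ℤ.+ m)) (ℤ.*-identityʳ (ℤ.+ n)))))))))

ι-* : ∀ m n → ι (m * n) ≡ ι m ℚ.* ι n
ι-* m n = ℚ.toℚᵘ-injective (ℚᵘ.≃-trans (toℚᵘ-/ (m * n) 0) (ℚᵘ.≃-sym
  (ℚᵘ.≃-trans (ℚ.toℚᵘ-homo-* (ι m) (ι n)) (ℚᵘ.≃-trans (ℚᵘ.*-cong (toℚᵘ-/ m 0) (toℚᵘ-/ n 0))
    (*≡* (cong (ℤ._* ℤ.+ 1) (sym (ℤ.pos-* m n))))))))

ι-mono-≤ : ∀ {m n} → m ≤ n → ι m ℚ.≤ ι n
ι-mono-≤ {m} {n} m≤n = ℚ.toℚᵘ-cancel-≤ (ℚᵘ.≤-respˡ-≃ (ℚᵘ.≃-sym (toℚᵘ-/ m 0))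
  (ℚᵘ.≤-respʳ-≃ (ℚᵘ.≃-sym (toℚᵘ-/ n 0)) (*≤* (ℤ.*-monoʳ-≤-nonNeg (ℤ.+ 1) (ℤ.+≤+ m≤n)))))

ι-mono-< : ∀ {m n} → m < n → ι m ℚ.< ι n
ι-mono-< {m} {n} m<n = ℚ.toℚᵘ-cancel-< (ℚᵘ.<-respˡ-≃ (ℚᵘ.≃-sym (toℚᵘ-/ m 0))
  (ℚᵘ.<-respʳ-≃ (ℚᵘ.≃-sym (toℚᵘ-/ n 0)) (*<* (ℤ.*-monoʳ-<-pos (ℤ.+ 1) (ℤ.+<+ m<n)))))

ι-positive : ∀ n → .{{NonZero n}} → ℚ.Positive (ι n)
ι-positive n@(suc _) = ℚ.positive (ι-mono-< {0} {n} (s≤s z≤n))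

-- Fractions are handled through this equation: clear the denominator, compute with naturals, then
-- cancel.
/-*-ι : ∀ a b .{{_ : NonZero b}} → (ℤ.+ a / b) ℚ.* ι b ≡ ι a
/-*-ι a (suc b) = ℚ.toℚᵘ-injective (ℚᵘ.≃-trans (ℚ.toℚᵘ-homo-* (ℤ.+ a / suc b) (ι (suc b)))
  (ℚᵘ.≃-trans (ℚᵘ.*-cong (toℚᵘ-/ a b) (toℚᵘ-/ (suc b) 0))
  (ℚᵘ.≃-trans (*≡* (ℤ.*-assoc (ℤ.+ a) (ℤ.+ suc b) (ℤ.+ 1))) (ℚᵘ.≃-sym (toℚᵘ-/ a 0)))))

*-cancelʳ-≡-pos : ∀ r .{{_ : ℚ.Positive r}} {p q} → p ℚ.* r ≡ q ℚ.* r → p ≡ q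
*-cancelʳ-≡-pos r eq = ℚ.≤-antisym (ℚ.*-cancelʳ-≤-pos r (ℚ.≤-reflexive eq))
                                   (ℚ.*-cancelʳ-≤-pos r (ℚ.≤-reflexive (sym eq)))

0≤p*q : ∀ {p q} → 0ℚ ℚ.≤ p → 0ℚ ℚ.≤ q → 0ℚ ℚ.≤ p ℚ.* q
0≤p*q {p} {q} 0≤p 0≤q = subst (ℚ._≤ p ℚ.* q) (ℚ.*-zeroˡ q)
  (ℚ.*-monoʳ-≤-nonNeg q {{ℚ.nonNegative 0≤q}} 0≤p)

0<p*q : ∀ {p q} → 0ℚ ℚ.< p → 0ℚ ℚ.< q → 0ℚ ℚ.< p ℚ.* q
0<p*q {p} {q} 0<p 0<q = subst (ℚ._< p ℚ.* q) (ℚ.*-zeroˡ q)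
  (ℚ.*-monoˡ-<-pos q {{ℚ.positive 0<q}} 0<p)

module _ (a b : ℕ) .{{_ : NonZero b}} (a≤b : a ≤ b) where

  private
    x = ℤ.+ a / b
    instance
      b-pos : ℚ.Positive (ι b)
      b-pos = ι-positive b

  0≤ratio : 0ℚ ℚ.≤ x
  0≤ratio = ℚ.*-cancelʳ-≤-pos (ι b)
    (subst₂ ℚ._≤_ (sym (ℚ.*-zeroˡ (ι b))) (sym (/-*-ι a b)) (ι-mono-≤ {0} {a} z≤n))

  ratio≤1 : x ℚ.≤ 1ℚ
  ratio≤1 = ℚ.*-cancelʳ-≤-pos (ι b)
    (subst₂ ℚ._≤_ (sym (/-*-ι a b)) (sym (ℚ.*-identityˡ (ι b))) (ι-mono-≤ a≤b))

  ∣ratio∣≤1 : ℚ.∣ x ∣ ℚ.≤ 1ℚ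
  ∣ratio∣≤1 = subst (ℚ._≤ 1ℚ) (sym (ℚ.0≤p⇒∣p∣≡p 0≤ratio)) ratio≤1

-- For x = a / b this is F / b² with the `F` of `Near`. It equals 8 - (3 - x)², with zeros 3 ± 2√2.
defect : ℚ → ℚ
defect x = ι 6 ℚ.* x ℚ.- x ℚ.* x ℚ.- 1ℚ

near⇒defect : ∀ n a b .{{_ : NonZero b}} → Near n a b →
  0ℚ ℚ.≤ defect (ℤ.+ a / b) × ι (2 + n) ℚ.* defect (ℤ.+ a / b) ℚ.≤ ι 4
near⇒defect n a b (_ , F , eq , F≤) =
  ℚ.*-cancelʳ-≤-pos (ι b ℚ.* ι b) (subst₂ ℚ._≤_ (sym (ℚ.*-zeroˡ (ι b ℚ.* ι b))) (sym scaled) (ι-mono-≤ {0} {F} z≤n)) ,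
  ℚ.*-cancelʳ-≤-pos (ι b ℚ.* ι b) (subst₂ ℚ._≤_
    (trans (ι-* (2 + n) F) (trans (cong (ι (2 + n) ℚ.*_) (sym scaled)) (sym (ℚ.*-assoc (ι (2 + n)) (defect x) _))))
    (trans (ι-* 4 (b * b)) (cong (ι 4 ℚ.*_) (ι-* b b))) (ι-mono-≤ F≤))
  where
  x = ℤ.+ a / b
  B = ι b

  instance
    b²-pos : ℚ.Positive (ι b ℚ.* ι b)
    b²-pos = subst ℚ.Positive (ι-* b b) (ι-positive (b * b) {{m*n≢0 b b}})

  xb : x ℚ.* B ≡ ι a
  xb = /-*-ι a b

  F≡ : ι a ℚ.* ι a ℚ.+ B ℚ.* B ℚ.+ ι F ≡ ι 6 ℚ.* ι a ℚ.* B
  F≡ = trans (sym (trans (ι-+ (a * a + b * b) F) (cong (ℚ._+ ι F)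
      (trans (ι-+ (a * a) (b * b)) (cong₂ ℚ._+_ (ι-* a a) (ι-* b b))))))
    (trans (cong ι eq) (trans (ι-* (6 * a) b) (cong (ℚ._* B) (ι-* 6 a))))

  scaled : defect x ℚ.* (B ℚ.* B) ≡ ι F
  scaled = trans (solve 3 (λ s x b → (s :* x :- x :* x :- con 1ℚ) :* (b :* b) :=
                    s :* (x :* b) :* b :- (x :* b) :* (x :* b) :- b :* b) refl (ι 6) x B)
    (trans (cong (λ z → ι 6 ℚ.* z ℚ.* B ℚ.- z ℚ.* z ℚ.- B ℚ.* B) xb)
    (trans (cong (λ z → z ℚ.- ι a ℚ.* ι a ℚ.- B ℚ.* B) (sym F≡))
      (solve 3 (λ a b f → a :* a :+ b :* b :+ f :- a :* a :- b :* b := f) refl (ι a) B (ι F))))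

-- With y = 3 − x, (2 r − y) (2 r + y) = 4 (r² − 2) + (8 − y²), where
-- 8 − y² = defect x and 2 r + y ≥ 1.
defect-bound : ∀ x r → 0ℚ ℚ.≤ r → x ℚ.≤ 1ℚ → 0ℚ ℚ.≤ defect x →
  ℚ.∣ x ℚ.- (ι 3 ℚ.- ι 2 ℚ.* r) ∣ ℚ.≤ ι 4 ℚ.* ℚ.∣ r ℚ.* r ℚ.- ι 2 ∣ ℚ.+ defect x
defect-bound x r 0≤r x≤1 0≤d = begin
  ℚ.∣ z ∣                                  ≡⟨ sym (ℚ.*-identityʳ ℚ.∣ z ∣) ⟩
  ℚ.∣ z ∣ ℚ.* 1ℚ                           ≤⟨ ℚ.*-monoˡ-≤-nonNeg ℚ.∣ z ∣ {{ℚ.∣-∣-nonNeg z}} 1≤s ⟩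
  ℚ.∣ z ∣ ℚ.* s                            ≡⟨ cong (ℚ.∣ z ∣ ℚ.*_) (sym (ℚ.0≤p⇒∣p∣≡p 0≤s)) ⟩
  ℚ.∣ z ∣ ℚ.* ℚ.∣ s ∣                      ≡⟨ sym (ℚ.∣p*q∣≡∣p∣*∣q∣ z s) ⟩
  ℚ.∣ z ℚ.* s ∣                            ≡⟨ cong ℚ.∣_∣ (factor x r) ⟩
  ℚ.∣ ι 4 ℚ.* e ℚ.+ defect x ∣             ≤⟨ ℚ.∣p+q∣≤∣p∣+∣q∣ (ι 4 ℚ.* e) (defect x) ⟩
  ℚ.∣ ι 4 ℚ.* e ∣ ℚ.+ ℚ.∣ defect x ∣       ≡⟨ cong₂ ℚ._+_ (ℚ.∣p*q∣≡∣p∣*∣q∣ (ι 4) e) (ℚ.0≤p⇒∣p∣≡p 0≤d) ⟩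
  ι 4 ℚ.* ℚ.∣ e ∣ ℚ.+ defect x             ∎
  where
  open ℚ.≤-Reasoning
  z = x ℚ.- (ι 3 ℚ.- ι 2 ℚ.* r)
  s = ι 2 ℚ.* r ℚ.+ (ι 2 ℚ.+ (1ℚ ℚ.- x))
  e = r ℚ.* r ℚ.- ι 2

  factor : ∀ x r → (x ℚ.- (ι 3 ℚ.- ι 2 ℚ.* r)) ℚ.* (ι 2 ℚ.* r ℚ.+ (ι 2 ℚ.+ (1ℚ ℚ.- x))) ≡
                   ι 4 ℚ.* (r ℚ.* r ℚ.- ι 2) ℚ.+ defect x
  factor = solve 2 (λ x r →
    (x :- (con (ι 3) :- con (ι 2) :* r)) :* (con (ι 2) :* r :+ (con (ι 2) :+ (con 1ℚ :- x))) :=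
    con (ι 4) :* (r :* r :- con (ι 2)) :+ (con (ι 6) :* x :- x :* x :- con 1ℚ)) refl

  -- Here x ≤ 1 excludes the neighbourhood of the other root 3 + 2√2.
  1≤s : 1ℚ ℚ.≤ s
  1≤s = begin
    1ℚ                                    ≤⟨ ι-mono-≤ {1} {2} (s≤s z≤n) ⟩
    ι 2                                   ≡⟨ sym (ℚ.+-identityʳ (ι 2)) ⟩
    ι 2 ℚ.+ 0ℚ                            ≤⟨ ℚ.+-monoʳ-≤ (ι 2) (subst (ℚ._≤ 1ℚ ℚ.- x) (ℚ.+-inverseʳ x) (ℚ.+-monoˡ-≤ (ℚ.- x) x≤1)) ⟩
    ι 2 ℚ.+ (1ℚ ℚ.- x)                    ≡⟨ sym (ℚ.+-identityˡ _) ⟩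
    0ℚ ℚ.+ (ι 2 ℚ.+ (1ℚ ℚ.- x))           ≤⟨ ℚ.+-monoˡ-≤ _ (0≤p*q (ι-mono-≤ {0} {2} z≤n) 0≤r) ⟩
    s                                     ∎

  0≤s : 0ℚ ℚ.≤ s
  0≤s = ℚ.≤-trans (ι-mono-≤ {0} {1} z≤n) 1≤s

-- Limits of rational sequences.

-- Convergence to the real number whose Cauchy sequence is L.
infix 4 _⇝_
record _⇝_ (x L : ℕ → ℚ) : Set where
  constructor converges
  field
    limit : ∀ ε → 0ℚ ℚ.< ε → ∃ λ N → ∀ n → N ≤ n → ∃ λ M → ∀ m → M ≤ m → ℚ.∣ x n ℚ.- L m ∣ ℚ.< ε

⇝⇒⟶ : ∀ {x} L → x ⇝ seq L → (λ n → fromℚ (x n)) ⟶ L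
⇝⇒⟶ {x} L (converges h) ε (δ , 0<δ , M , ε≥) =
  -- One half of `δ` bounds the error, the other half is the gap that `_<ᴿ_` asks for.
  let N , hN = h (½ ℚ.* δ) (0<p*q {½} {δ} (ℚ.positive⁻¹ ½) 0<δ) in N , λ n N≤n →
  let M′ , hM = hN n N≤n in ½ ℚ.* δ , 0<p*q {½} {δ} (ℚ.positive⁻¹ ½) 0<δ , M ℕ.⊔ M′ , λ m m≥ →
  let open ℚ.≤-Reasoning in begin
    ℚ.∣ x n ℚ.- seq L m ∣ ℚ.+ ½ ℚ.* δ   ≤⟨ ℚ.+-monoˡ-≤ (½ ℚ.* δ) (ℚ.<⇒≤ (hM m (m⊔n≤o⇒n≤o M M′ m≥))) ⟩
    ½ ℚ.* δ ℚ.+ ½ ℚ.* δ                 ≡⟨ solve 1 (λ d → con ½ :* d :+ con ½ :* d := con 0ℚ :+ d) refl δ ⟩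
    0ℚ ℚ.+ δ                            ≤⟨ ε≥ m (m⊔n≤o⇒m≤o M M′ m≥) ⟩
    seq ε m                             ∎

⇝-shift : ∀ {x L} j → x ⇝ L → (λ n → x (j + n)) ⇝ L
⇝-shift j (converges h) = converges λ ε 0<ε → let N , hN = h ε 0<ε in N , λ n N≤n → hN (j + n) (≤-trans N≤n (m≤n+m n j))

-- Discards the indices n ≤ j, about which the hypothesis on the sequence `k` says nothing.
⇝-eventually : ∀ {x y L} j → (∀ n → j < n → x n ≡ y (n ∸ j)) → y ⇝ L → x ⇝ L
⇝-eventually {x} {y} {L} j eq (converges h) = converges λ ε 0<ε → let N , hN = h ε 0<ε in suc j + N , λ n n≥ →
  let M , hM = hN (n ∸ j) (≤-trans (≤-trans (n≤1+n N) (≤-reflexive (sym (m+n∸m≡n j (suc N)))))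
                 (∸-monoˡ-≤ j (≤-trans (≤-reflexive (+-suc j N)) n≥)))
  in M , λ m m≥ → subst (λ z → ℚ.∣ z ℚ.- L m ∣ ℚ.< ε) (sym (eq n (≤-trans (m≤m+n (suc j) N) n≥))) (hM m m≥)

⇝-cong : ∀ {x y L K} → (∀ n → x n ≡ y n) → (∀ m → L m ≡ K m) → x ⇝ L → y ⇝ K
⇝-cong p q (converges h) = converges λ ε 0<ε → let N , hN = h ε 0<ε in N , λ n N≤n →
  let M , hM = hN n N≤n in M , λ m m≥ → subst₂ (λ u v → ℚ.∣ u ℚ.- v ∣ ℚ.< ε) (p n) (q m) (hM m m≥)

⇝-const : ∀ q → (λ _ → q) ⇝ (λ _ → q)
⇝-const q = converges λ ε 0<ε → 0 , λ _ _ → 0 , λ _ _ →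
  subst (ℚ._< ε) (sym (cong ℚ.∣_∣ (ℚ.+-inverseʳ q))) 0<ε

0<1/ : ∀ k → 0ℚ ℚ.< ℤ.+ 1 / suc k
0<1/ k = ℚ.positive⁻¹ _ {{ℚ.normalize-pos 1 (suc k)}}

⇝-scale : ∀ {x L} k → x ⇝ L → (λ n → ι k ℚ.* x n) ⇝ (λ m → ι k ℚ.* L m)
⇝-scale {x} {L} k (converges h) = converges λ ε 0<ε →
  -- Dividing by k + 1 instead of k covers k = 0 without a separate case.
  let δ      = (ℤ.+ 1 / suc k) ℚ.* ε
      N , hN = h δ (0<p*q (0<1/ k) 0<ε)
  in N , λ n N≤n →
  let M , hM = hN n N≤n in M , λ m m≥ →
  let open ℚ.≤-Reasoning ; d = x n ℚ.- L m in begin-strict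
    ℚ.∣ ι k ℚ.* x n ℚ.- ι k ℚ.* L m ∣
      ≡⟨ cong ℚ.∣_∣ (solve 3 (λ k x l → k :* x :- k :* l := k :* (x :- l)) refl (ι k) (x n) (L m)) ⟩
    ℚ.∣ ι k ℚ.* d ∣           ≡⟨ ℚ.∣p*q∣≡∣p∣*∣q∣ (ι k) d ⟩
    ℚ.∣ ι k ∣ ℚ.* ℚ.∣ d ∣      ≡⟨ cong (ℚ._* ℚ.∣ d ∣) (ℚ.0≤p⇒∣p∣≡p (ι-mono-≤ {0} {k} z≤n)) ⟩
    ι k ℚ.* ℚ.∣ d ∣           ≤⟨ ℚ.*-monoʳ-≤-nonNeg ℚ.∣ d ∣ {{ℚ.∣-∣-nonNeg d}} (ι-mono-≤ (n≤1+n k)) ⟩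
    ι (suc k) ℚ.* ℚ.∣ d ∣     <⟨ ℚ.*-monoʳ-<-pos (ι (suc k)) {{ι-positive (suc k)}} (hM m m≥) ⟩
    ι (suc k) ℚ.* δ           ≡⟨ sym (ℚ.*-assoc (ι (suc k)) (ℤ.+ 1 / suc k) ε) ⟩
    ι (suc k) ℚ.* (ℤ.+ 1 / suc k) ℚ.* ε
      ≡⟨ cong (ℚ._* ε) (trans (ℚ.*-comm (ι (suc k)) _) (/-*-ι 1 (suc k))) ⟩
    1ℚ ℚ.* ε                  ≡⟨ ℚ.*-identityˡ ε ⟩
    ε                         ∎

∣p*q∣≤∣q∣ : ∀ p q → ℚ.∣ p ∣ ℚ.≤ 1ℚ → ℚ.∣ p ℚ.* q ∣ ℚ.≤ ℚ.∣ q ∣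
∣p*q∣≤∣q∣ p q ∣p∣≤1 = subst₂ ℚ._≤_ (sym (ℚ.∣p*q∣≡∣p∣*∣q∣ p q)) (ℚ.*-identityˡ ℚ.∣ q ∣)
  (ℚ.*-monoʳ-≤-nonNeg ℚ.∣ q ∣ {{ℚ.∣-∣-nonNeg q}} ∣p∣≤1)

-- With p = x - l and q = y - k the error is x q + y p - p q, so bounds on the two sequences suffice
-- and none is needed on the limits. The third term uses ∣p∣ ≤ 1, whence the extra threshold `N₂`;
-- each term gets a third of `ε`.
⇝-* : ∀ {x y L K} → (∀ n → ℚ.∣ x n ∣ ℚ.≤ 1ℚ) → (∀ n → ℚ.∣ y n ∣ ℚ.≤ 1ℚ) →
      x ⇝ L → y ⇝ K → (λ n → x n ℚ.* y n) ⇝ (λ m → L m ℚ.* K m)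
⇝-* {x} {y} {L} {K} x≤1 y≤1 (converges hx) (converges hy) = converges λ ε 0<ε →
  let δ       = (ℤ.+ 1 / 3) ℚ.* ε
      0<δ     = 0<p*q (0<1/ 2) 0<ε
      N₁ , h₁ = hx δ 0<δ
      N₂ , h₂ = hx 1ℚ (0<1/ 0)
      N₃ , h₃ = hy δ 0<δ
  in N₁ ℕ.⊔ N₂ ℕ.⊔ N₃ , λ n n≥ →
  let n≥₁₂ = m⊔n≤o⇒m≤o (N₁ ℕ.⊔ N₂) N₃ n≥
      M₁ , g₁ = h₁ n (m⊔n≤o⇒m≤o N₁ N₂ n≥₁₂)
      M₂ , g₂ = h₂ n (m⊔n≤o⇒n≤o N₁ N₂ n≥₁₂)
      M₃ , g₃ = h₃ n (m⊔n≤o⇒n≤o (N₁ ℕ.⊔ N₂) N₃ n≥)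
  in M₁ ℕ.⊔ M₂ ℕ.⊔ M₃ , λ m m≥ →
  let m≥₁₂ = m⊔n≤o⇒m≤o (M₁ ℕ.⊔ M₂) M₃ m≥
  in close (x n) (y n) (L m) (K m) (x≤1 n) (y≤1 n)
       (g₁ m (m⊔n≤o⇒m≤o M₁ M₂ m≥₁₂))
       (ℚ.<⇒≤ (g₂ m (m⊔n≤o⇒n≤o M₁ M₂ m≥₁₂)))
       (g₃ m (m⊔n≤o⇒n≤o (M₁ ℕ.⊔ M₂) M₃ m≥))
  where
  close : ∀ x y l k {ε} → let δ = (ℤ.+ 1 / 3) ℚ.* ε in ℚ.∣ x ∣ ℚ.≤ 1ℚ → ℚ.∣ y ∣ ℚ.≤ 1ℚ → ℚ.∣ x ℚ.- l ∣ ℚ.< δ → ℚ.∣ x ℚ.- l ∣ ℚ.≤ 1ℚ →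
          ℚ.∣ y ℚ.- k ∣ ℚ.< δ → ℚ.∣ x ℚ.* y ℚ.- l ℚ.* k ∣ ℚ.< ε
  close x y l k {ε} x≤ y≤ p<δ p≤1 q<δ = begin-strict
    ℚ.∣ x ℚ.* y ℚ.- l ℚ.* k ∣
      ≡⟨ cong ℚ.∣_∣ (solve 4 (λ x y l k →
           x :* y :- l :* k := x :* (y :- k) :+ (y :* (x :- l) :+ (x :- l) :* (:- (y :- k)))) refl x y l k) ⟩
    ℚ.∣ x ℚ.* q ℚ.+ (y ℚ.* p ℚ.+ p ℚ.* (ℚ.- q)) ∣
      ≤⟨ ℚ.∣p+q∣≤∣p∣+∣q∣ (x ℚ.* q) (y ℚ.* p ℚ.+ p ℚ.* (ℚ.- q)) ⟩
    ℚ.∣ x ℚ.* q ∣ ℚ.+ ℚ.∣ y ℚ.* p ℚ.+ p ℚ.* (ℚ.- q) ∣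
      ≤⟨ ℚ.+-monoʳ-≤ ℚ.∣ x ℚ.* q ∣ (ℚ.∣p+q∣≤∣p∣+∣q∣ (y ℚ.* p) (p ℚ.* (ℚ.- q))) ⟩
    ℚ.∣ x ℚ.* q ∣ ℚ.+ (ℚ.∣ y ℚ.* p ∣ ℚ.+ ℚ.∣ p ℚ.* (ℚ.- q) ∣)
      ≤⟨ ℚ.+-mono-≤ (∣p*q∣≤∣q∣ x q x≤) (ℚ.+-mono-≤ (∣p*q∣≤∣q∣ y p y≤) (∣p*q∣≤∣q∣ p (ℚ.- q) p≤1)) ⟩
    ℚ.∣ q ∣ ℚ.+ (ℚ.∣ p ∣ ℚ.+ ℚ.∣ ℚ.- q ∣)
      ≡⟨ cong (λ z → ℚ.∣ q ∣ ℚ.+ (ℚ.∣ p ∣ ℚ.+ z)) (ℚ.∣-p∣≡∣p∣ q) ⟩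
    ℚ.∣ q ∣ ℚ.+ (ℚ.∣ p ∣ ℚ.+ ℚ.∣ q ∣)
      <⟨ ℚ.+-mono-< q<δ (ℚ.+-mono-< p<δ q<δ) ⟩
    δ ℚ.+ (δ ℚ.+ δ)
      ≡⟨ solve 1 (λ e → con (ℤ.+ 1 / 3) :* e :+ (con (ℤ.+ 1 / 3) :* e :+ con (ℤ.+ 1 / 3) :* e) := e) refl ε ⟩
    ε ∎
    where
    open ℚ.≤-Reasoning
    δ = (ℤ.+ 1 / 3) ℚ.* ε
    p = x ℚ.- l
    q = y ℚ.- k

positive-fraction : ∀ ε → 0ℚ ℚ.< ε → ∃₂ λ e d → ℤ.+ suc e / suc d ≡ ε
positive-fraction ε@(ℚ.mkℚ (ℤ.+ suc e) d _)  0<ε = e , d , ℚ.↥p/↧p≡p ε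
positive-fraction ε@(ℚ.mkℚ (ℤ.+ zero) d _)   0<ε with ℚ.positive {ε} 0<ε
... | ()
positive-fraction ε@(ℚ.mkℚ ℤ.-[1+ _ ] d _) 0<ε with ℚ.positive {ε} 0<ε
... | ()

archimedean-4 : ∀ ε → 0ℚ ℚ.< ε → ∃ λ N → ∀ n → N ≤ n → ι 4 ℚ.< ι (2 + n) ℚ.* ε
archimedean-4 ε 0<ε with positive-fraction ε 0<ε
... | e , d , eq = 4 * suc d , λ n n≥ → let open ℚ.≤-Reasoning in begin-strict
  ι 4                          ≤⟨ ι-mono-≤ (m≤m*n 4 (suc e)) ⟩
  ι (4 * suc e)                ≡⟨ ι-* 4 (suc e) ⟩
  ι 4 ℚ.* ι (suc e)            ≡⟨ cong (ι 4 ℚ.*_) (sym (trans (cong (ℚ._* ι (suc d)) (sym eq)) (/-*-ι (suc e) (suc d)))) ⟩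
  ι 4 ℚ.* (ε ℚ.* ι (suc d))    ≡⟨ solve 3 (λ f e d → f :* (e :* d) := f :* d :* e) refl (ι 4) ε (ι (suc d)) ⟩
  ι 4 ℚ.* ι (suc d) ℚ.* ε      ≡⟨ cong (ℚ._* ε) (sym (ι-* 4 (suc d))) ⟩
  ι (4 * suc d) ℚ.* ε          <⟨ ℚ.*-monoˡ-<-pos ε {{ℚ.positive 0<ε}} (ι-mono-< (s≤s (m≤n⇒m≤1+n n≥))) ⟩
  ι (2 + n) ℚ.* ε              ∎

√-seq-nonNeg : ∀ m n → 0ℚ ℚ.≤ √-seq m n
√-seq-nonNeg m n = ℚ.nonNegative⁻¹ _ {{ℚ.normalize-nonNeg (proj₁ (floorSqrt (m * (suc n * suc n)))) (suc n)}}

3-2√2 : ℝ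
3-2√2 = fromℕ 3 -ᴿ fromℕ 2 *ᴿ √ 2

module Ratios (w : ℕ → ℕ) (w≢0 : ∀ n → NonZero (w n)) (nearby : ∀ n → Near n (w n) (w (1 + n))) where

  -- When `w n` is s_{n+1}, the lag `i` is l - 1 and the value is s_{n+1} / s_{n+l}.
  ratio : ℕ → ℕ → ℚ
  ratio i n = _/_ (ℤ.+ w n) (w (i + n)) {{w≢0 (i + n)}}

  w-mono : ∀ i n → w n ≤ w (i + n)
  w-mono zero    n = ≤-refl
  w-mono (suc i) n = ≤-trans (w-mono i n) (proj₁ (nearby (i + n)))

  ratio-bounded : ∀ i n → ℚ.∣ ratio i n ∣ ℚ.≤ 1ℚ
  ratio-bounded i n = ∣ratio∣≤1 (w n) (w (i + n)) {{w≢0 (i + n)}} (w-mono i n)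

  ratio-1 : ratio 1 ⇝ seq 3-2√2
  ratio-1 = converges λ ε 0<ε →
    let N , hN = archimedean-4 (½ ℚ.* ε) (0<p*q {½} {ε} (0<1/ 1) 0<ε)
        -- The factor 4 in `defect-bound` turns this eighth into the half of `ε` that the defect
        -- leaves over.
        M , hM = √-square 2 ((ℤ.+ 1 / 8) ℚ.* ε) (0<p*q (0<1/ 7) 0<ε)
    in N , λ n N≤n → M , λ m M≤m →
    let x = ratio 1 n
        r = √-seq 2 m
        0≤d , d≤ = near⇒defect n (w n) (w (1 + n)) {{w≢0 (1 + n)}} (nearby n)
        open ℚ.≤-Reasoning
    in begin-strict
      ℚ.∣ x ℚ.- seq 3-2√2 m ∣
        ≤⟨ defect-bound x r (√-seq-nonNeg 2 m)
             (ratio≤1 (w n) (w (1 + n)) {{w≢0 (1 + n)}} (w-mono 1 n)) 0≤d ⟩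
      ι 4 ℚ.* ℚ.∣ r ℚ.* r ℚ.- ι 2 ∣ ℚ.+ defect x
        <⟨ ℚ.+-mono-< (ℚ.*-monoʳ-<-pos (ι 4) (hM m M≤m))
             (ℚ.*-cancelˡ-<-nonNeg (ι (2 + n)) {{ℚ.nonNegative (ι-mono-≤ {0} {2 + n} z≤n)}}
               (ℚ.≤-<-trans d≤ (hN n N≤n))) ⟩
      ι 4 ℚ.* ((ℤ.+ 1 / 8) ℚ.* ε) ℚ.+ ½ ℚ.* ε
        ≡⟨ solve 1 (λ e → con (ι 4) :* (con (ℤ.+ 1 / 8) :* e) :+ con ½ :* e := e) refl ε ⟩
      ε ∎

  ratio-suc : ∀ i n → ratio 1 (i + n) ℚ.* ratio i n ≡ ratio (suc i) n
  ratio-suc i n = *-cancelʳ-≡-pos (ι c) {{ι-positive c {{w≢0 (suc i + n)}}}}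
    (trans (solve 3 (λ x y c → x :* y :* c := y :* (x :* c)) refl (ratio 1 (i + n)) (ratio i n) (ι c))
    (trans (cong (ratio i n ℚ.*_) (/-*-ι (w (i + n)) c {{w≢0 (suc i + n)}}))
    (trans (/-*-ι (w n) (w (i + n)) {{w≢0 (i + n)}}) (sym (/-*-ι (w n) c {{w≢0 (suc i + n)}})))))
    where c = w (suc i + n)

  -- For a variable c, so that the powers of 3 − 2 √2 are not unfolded.
  ratio-⇝-^ : (c : ℝ) → ratio 1 ⇝ seq c → ∀ i → ratio i ⇝ seq (c ^ᴿ i)
  ratio-⇝-^ c h zero    = ⇝-cong
    (λ n → *-cancelʳ-≡-pos (ι (w n)) {{ι-positive (w n) {{w≢0 n}}}}
      (trans (ℚ.*-identityˡ (ι (w n))) (sym (/-*-ι (w n) (w n) {{w≢0 n}}))))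
    (λ _ → refl) (⇝-const 1ℚ)
  ratio-⇝-^ c h (suc i) = ⇝-cong (ratio-suc i) (λ _ → refl)
    (⇝-* (λ n → ratio-bounded 1 (i + n)) (ratio-bounded i) (⇝-shift i h) (ratio-⇝-^ c h i))

  ratio-⇝ : ∀ i → ratio i ⇝ seq (3-2√2 ^ᴿ i)
  ratio-⇝ = ratio-⇝-^ 3-2√2 ratio-1

-- Lists: concatenation, intervals and counting by bijections.

private variable
  X Y : Set
  x y k l n : ℕ
  xs ys zs σ τ π : List ℕ

map-cong-∈ : {f g : X → Y} (xs : List X) → (∀ {x} → x ∈ xs → f x ≡ g x) → map f xs ≡ map g xs
map-cong-∈ []       h = refl
map-cong-∈ (x ∷ xs) h = cong₂ _∷_ (h (here refl)) (map-cong-∈ xs (h ∘ there))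

concatMap-[] : {f : X → List Y} (xs : List X) → (∀ {x} → x ∈ xs → f x ≡ []) → concatMap f xs ≡ []
concatMap-[] []       h = refl
concatMap-[] (x ∷ xs) h rewrite h (here refl) = concatMap-[] xs (h ∘ there)

concatMap-[-] : {f : X → List Y} (g : X → Y) (xs : List X) → (∀ {x} → x ∈ xs → f x ≡ [ g x ]) →
                concatMap f xs ≡ map g xs
concatMap-[-] g []       h = refl
concatMap-[-] g (x ∷ xs) h rewrite h (here refl) = cong (g x ∷_) (concatMap-[-] g xs (h ∘ there))

concatMap-id : {f : X → List X} (xs : List X) → (∀ {x} → x ∈ xs → f x ≡ [ x ]) → concatMap f xs ≡ xs
concatMap-id xs h = trans (concatMap-[-] (λ x → x) xs h) (List.map-id xs)

concatMap-concatMap : ∀ {Z : Set} (f : Y → List Z) (g : X → List Y) xs →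
                      concatMap f (concatMap g xs) ≡ concatMap (concatMap f ∘ g) xs
concatMap-concatMap f g []       = refl
concatMap-concatMap f g (x ∷ xs) =
  trans (List.concatMap-++ f (g x) (concatMap g xs))
        (cong (concatMap f (g x) ++_) (concatMap-concatMap f g xs))

concatMap-↭ : (f : X → List Y) {xs ys : List X} → xs ↭ ys → concatMap f xs ↭ concatMap f ys
concatMap-↭ f Perm.refl        = ↭-refl
concatMap-↭ f (prep x p)       = ↭.++⁺ˡ (f x) (concatMap-↭ f p)
concatMap-↭ f (Perm.swap {xs} {ys} x y p) =
  ↭-trans (↭.shifts (f x) (f y)) (↭.++⁺ˡ (f y) (↭.++⁺ˡ (f x) (concatMap-↭ f p)))
concatMap-↭ f (Perm.trans p q) = ↭-trans (concatMap-↭ f p) (concatMap-↭ f q)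

∈-concatMap-find : (f : X → List Y) (xs : List X) {y : Y} → y ∈ concatMap f xs →
                   ∃ λ x → x ∈ xs × y ∈ f x
∈-concatMap-find f xs = find ∘ ∈-concatMap⁻ f {xs = xs}

applyUpTo-cong : {f g : ℕ → X} → f ≗ g → ∀ n → applyUpTo f n ≡ applyUpTo g n
applyUpTo-cong h zero    = refl
applyUpTo-cong h (suc n) = cong₂ _∷_ (h 0) (applyUpTo-cong (h ∘ suc) n)

applyUpTo-++ : (f : ℕ → X) → ∀ m n → applyUpTo f (m + n) ≡ applyUpTo f m ++ applyUpTo (f ∘ (m +_)) n
applyUpTo-++ f zero    n = refl
applyUpTo-++ f (suc m) n = cong (f 0 ∷_) (applyUpTo-++ (f ∘ suc) m n)

∈-[1⋯] : x ∈ [1⋯ n ] → 1 ≤ x × x ≤ n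
∈-[1⋯] x∈ with ∈-applyUpTo⁻ suc x∈
... | _ , i<n , refl = s≤s z≤n , i<n

unique-map : (f : X → Y) {xs : List X} → Unique xs →
             (∀ {x y} → x ∈ xs → y ∈ xs → f x ≡ f y → x ≡ y) → Unique (map f xs)
unique-map f []      inj = []
unique-map f {x ∷ xs} (x∉ ∷ u) inj =
  All.tabulate (λ fy∈ eq → let y , y∈ , eq′ = ∈-map⁻ f fy∈ in
    All.lookup x∉ y∈ (inj (here refl) (there y∈) (trans eq eq′)))
  ∷ unique-map f u (λ p q → inj (there p) (there q))

-- Duplicate-free lists with the same members are permutations of each other; this is applied to
-- `map f xs` and `ys`.
length-bijection : (f : X → Y) {xs : List X} {ys : List Y} → Unique xs → Unique ys →
  (∀ {x} → x ∈ xs → f x ∈ ys) →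
  (∀ {x y} → x ∈ xs → y ∈ xs → f x ≡ f y → x ≡ y) →
  (∀ {y} → y ∈ ys → ∃ λ x → x ∈ xs × f x ≡ y) →
  length xs ≡ length ys
length-bijection f {xs} {ys} u v to inj surj =
  trans (sym (List.length-map f xs)) (↭.↭-length (∼bag⇒↭ (unique∧set⇒bag (unique-map f u inj) v
    (mk⇔ (λ y∈ → let _ , x∈ , eq = ∈-map⁻ f y∈ in subst (_∈ ys) (sym eq) (to x∈))
         (λ y∈ → let _ , x∈ , eq = surj y∈ in subst (_∈ map f xs) eq (∈-map⁺ f x∈))))))

unique-++-disjoint : {xs ys : List X} {x : X} → Unique (xs ++ ys) → x ∈ xs → x ∉ ys
unique-++-disjoint {xs = x ∷ xs} (x∉ ∷ _) (here refl) x∈ys = All.lookup x∉ (∈-++⁺ʳ xs x∈ys) refl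
unique-++-disjoint (_ ∷ u) (there x∈xs) = unique-++-disjoint u x∈xs

-- Separability up to order isomorphism.

-- Separability without the requirement that the entries be 1,…,n: this makes
-- both subsequences and inflations instances of the single lemma Sep-concatMap.

data Sep : List ℕ → Set where
  empty : Sep []
  point : ∀ x → Sep [ x ]
  below : Sep xs → Sep ys → (∀ {x y} → x ∈ xs → y ∈ ys → x < y) → Sep (xs ++ ys)
  above : Sep xs → Sep ys → (∀ {x y} → x ∈ xs → y ∈ ys → y < x) → Sep (xs ++ ys)

StrictlyMonotone : (ℕ → List ℕ) → Set
StrictlyMonotone f = ∀ {x y u v} → x < y → u ∈ f x → v ∈ f y → u < v

-- If v ≤ u held, applying `g` would give y ≤ x. A case analysis over pairs of arguments becomes one
-- over single arguments.
retraction⇒strictlyMonotone : (f : ℕ → List ℕ) (g : ℕ → ℕ) → (∀ {u v} → u ≤ v → g u ≤ g v) →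
  (∀ x {u} → u ∈ f x → g u ≡ x) → StrictlyMonotone f
retraction⇒strictlyMonotone f g mono inv x<y u∈ v∈ =
  ≰⇒> λ v≤u → <⇒≱ x<y (subst₂ _≤_ (inv _ v∈) (inv _ u∈) (mono v≤u))

-- A strictly monotone substitution carries each split of `xs` to a split in the same direction.
-- Empty values of `f` delete entries, longer ones inflate them.
Sep-concatMap : (f : ℕ → List ℕ) → StrictlyMonotone f → (∀ x → Sep (f x)) → Sep xs → Sep (concatMap f xs)
Sep-concatMap f mono sep = go
  where
  go : Sep xs → Sep (concatMap f xs)
  go empty     = empty
  go (point x) = subst Sep (sym (List.++-identityʳ (f x))) (sep x)
  go (below {xs} {ys} p q lt) = subst Sep (sym (List.concatMap-++ f xs ys))
    (below (go p) (go q) λ u∈ v∈ →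
      let _ , x∈ , u∈′ = ∈-concatMap-find f xs u∈
          _ , y∈ , v∈′ = ∈-concatMap-find f ys v∈
      in mono (lt x∈ y∈) u∈′ v∈′)
  go (above {xs} {ys} p q gt) = subst Sep (sym (List.concatMap-++ f xs ys))
    (above (go p) (go q) λ u∈ v∈ →
      let _ , x∈ , u∈′ = ∈-concatMap-find f xs u∈
          _ , y∈ , v∈′ = ∈-concatMap-find f ys v∈
      in mono (gt x∈ y∈) v∈′ u∈′)

Sep-raise : ∀ m → Sep xs → Sep (map (m +_) xs)
Sep-raise {xs} m p = subst Sep (concatMap-[-] (m +_) xs (λ _ → refl))
  (Sep-concatMap (λ x → [ m + x ])
    (retraction⇒strictlyMonotone (λ x → [ m + x ]) (_∸ m) (∸-monoˡ-≤ m) λ { x (here refl) → m+n∸m≡n m x })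
    (λ x → point (m + x)) p)

raise-[1⋯] : ∀ m n → [1⋯ m ] ++ map (m +_) [1⋯ n ] ≡ [1⋯ m + n ]
raise-[1⋯] m n = trans
  (cong ([1⋯ m ] ++_) (trans (List.map-applyUpTo suc (m +_) n) (applyUpTo-cong (+-suc m) n)))
  (sym (applyUpTo-++ suc m n))

separable-↭ : Separable σ → σ ↭ [1⋯ length σ ]
separable-↭ singleton = ↭-refl
separable-↭ (direct {σ} {τ} p q)
  rewrite List.length-++ σ {map (length σ +_) τ} | List.length-map (length σ +_) τ =
  ↭-trans (↭.++⁺ (separable-↭ p) (↭.map⁺ (length σ +_) (separable-↭ q)))
          (↭-reflexive (raise-[1⋯] (length σ) (length τ)))
separable-↭ (skew {σ} {τ} p q)
  rewrite List.length-++ (map (length τ +_) σ) {τ} | List.length-map (length τ +_) σ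
        | +-comm (length σ) (length τ) =
  ↭-trans (↭.++-comm (map (length τ +_) σ) τ)
  (↭-trans (↭.++⁺ (separable-↭ q) (↭.map⁺ (length τ +_) (separable-↭ p)))
           (↭-reflexive (raise-[1⋯] (length τ) (length σ))))

separable-bounds : Separable σ → x ∈ σ → 1 ≤ x × x ≤ length σ
separable-bounds p x∈ = ∈-[1⋯] (↭.∈-resp-↭ (separable-↭ p) x∈)

separable⇒Sep : Separable σ → Sep σ
separable⇒Sep singleton = point 1
separable⇒Sep (direct {σ} {τ} p q) =
  below (separable⇒Sep p) (Sep-raise (length σ) (separable⇒Sep q)) λ x∈ y∈ →
    let z , z∈ , eq = ∈-map⁻ (length σ +_) y∈ in
    subst (_ <_) (sym eq) (≤-<-trans (proj₂ (separable-bounds p x∈))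
      (m<m+n (length σ) (proj₁ (separable-bounds q z∈))))
separable⇒Sep (skew {σ} {τ} p q) =
  above (Sep-raise (length τ) (separable⇒Sep p)) (separable⇒Sep q) λ x∈ y∈ →
    let z , z∈ , eq = ∈-map⁻ (length τ +_) x∈ in
    subst (_ <_) (sym eq) (≤-<-trans (proj₂ (separable-bounds q y∈))
      (m<m+n (length τ) (proj₁ (separable-bounds p z∈))))

rank : List ℕ → ℕ → ℕ
rank xs x = length (filter (_≤? x) xs)

standardise : List ℕ → List ℕ
standardise xs = map (rank xs) xs

rank-++ : ∀ xs ys x → rank (xs ++ ys) x ≡ rank xs x + rank ys x
rank-++ xs ys x = trans (cong length (List.filter-++ (_≤? x) xs ys)) (List.length-++ (filter (_≤? x) xs))

rank-all : ∀ xs → (∀ {y} → y ∈ xs → y ≤ x) → rank xs x ≡ length xs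
rank-all xs h = cong length (List.filter-all (_≤? _) (All.tabulate h))

rank-none : ∀ xs → (∀ {y} → y ∈ xs → x < y) → rank xs x ≡ 0
rank-none xs h = cong length (List.filter-none (_≤? _) (All.tabulate (<⇒≱ ∘ h)))

rank-[1⋯] : ∀ x n → x ≤ n → rank [1⋯ n ] x ≡ x
rank-[1⋯] zero    n       _         = rank-none [1⋯ n ] (proj₁ ∘ ∈-[1⋯])
rank-[1⋯] (suc x) (suc n) (s≤s x≤n) = cong suc (trans
  (cong (λ ys → rank ys (suc x)) (sym (List.map-applyUpTo suc suc n)))
  (trans (raised [1⋯ n ]) (rank-[1⋯] x n x≤n)))
  where
  raised : ∀ ys → rank (map suc ys) (suc x) ≡ rank ys x
  raised []       = refl
  raised (y ∷ ys) with y ≤? x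
  ... | yes y≤x = trans (cong length (List.filter-accept (_≤? suc x) {xs = map suc ys} (s≤s y≤x)))
    (trans (cong suc (raised ys)) (sym (cong length (List.filter-accept (_≤? x) {xs = ys} y≤x))))
  ... | no  y≰x = trans (cong length (List.filter-reject (_≤? suc x) {xs = map suc ys} (y≰x ∘ ≤-pred)))
    (trans (raised ys) (sym (cong length (List.filter-reject (_≤? x) {xs = ys} y≰x))))

-- Ranks of entries of `xs` do not see `ys`, while each rank of an entry of `ys` counts all of `xs`.
standardise-below : ∀ xs ys → (∀ {x y} → x ∈ xs → y ∈ ys → x < y) →
                    standardise xs ⊕ standardise ys ≡ standardise (xs ++ ys)
standardise-below xs ys lt rewrite List.length-map (rank xs) xs = sym (trans
  (List.map-++ (rank (xs ++ ys)) xs ys)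
  (cong₂ _++_
    (map-cong-∈ xs λ {x} x∈ → trans (rank-++ xs ys x)
      (trans (cong (rank xs x +_) (rank-none ys (lt x∈))) (+-identityʳ _)))
    (trans (map-cong-∈ ys λ {y} y∈ → trans (rank-++ xs ys y)
             (cong (_+ rank ys y) (rank-all xs λ x∈ → <⇒≤ (lt x∈ y∈))))
           (List.map-∘ ys))))

standardise-above : ∀ xs ys → (∀ {x y} → x ∈ xs → y ∈ ys → y < x) →
                    standardise xs ⊖ standardise ys ≡ standardise (xs ++ ys)
standardise-above xs ys gt rewrite List.length-map (rank ys) ys = sym (trans
  (List.map-++ (rank (xs ++ ys)) xs ys)
  (cong₂ _++_
    (trans (map-cong-∈ xs λ {x} x∈ → trans (rank-++ xs ys x)
             (trans (cong (rank xs x +_) (rank-all ys λ y∈ → <⇒≤ (gt x∈ y∈)))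
                    (+-comm (rank xs x) (length ys))))
           (List.map-∘ xs))
    (map-cong-∈ ys λ {y} y∈ → trans (rank-++ xs ys y)
      (cong (_+ rank ys y) (rank-none xs λ x∈ → gt x∈ y∈)))))

-- `Sep` allows empty parts and `Separable` does not, so a split with an empty part is dropped
-- before `direct` or `skew` applies.
standardise-separable : Sep xs → xs ≡ [] ⊎ Separable (standardise xs)
standardise-separable empty     = inj₁ refl
standardise-separable (point x)
  rewrite List.filter-accept (_≤? x) {xs = []} (≤-refl {x}) = inj₂ singleton
standardise-separable (below {xs} {ys} p q lt) with standardise-separable p | standardise-separable q
... | inj₁ refl | r         = r
... | inj₂ p′   | inj₁ refl = inj₂ (subst (Separable ∘ standardise) (sym (List.++-identityʳ xs)) p′)
... | inj₂ p′   | inj₂ q′   = inj₂ (subst Separable (standardise-below xs ys lt) (direct p′ q′))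
standardise-separable (above {xs} {ys} p q gt) with standardise-separable p | standardise-separable q
... | inj₁ refl | r         = r
... | inj₂ p′   | inj₁ refl = inj₂ (subst (Separable ∘ standardise) (sym (List.++-identityʳ xs)) p′)
... | inj₂ p′   | inj₂ q′   = inj₂ (subst Separable (standardise-above xs ys gt) (skew p′ q′))

standardise-↭ : ∀ n → σ ↭ [1⋯ n ] → standardise σ ≡ σ
standardise-↭ {σ} n p = trans
  (map-cong-∈ σ λ {x} x∈ → trans (↭.↭-length (↭.filter-↭ (_≤? x) p))
    (rank-[1⋯] x n (proj₂ (∈-[1⋯] (↭.∈-resp-↭ p x∈)))))
  (List.map-id σ)

-- A permutation of an initial interval is its own standardisation. The length is positive because
-- `Separable` excludes the empty list.
Sep⇒separable : ∀ n → Sep σ → σ ↭ [1⋯ suc n ] → Separable σ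
Sep⇒separable n s p with standardise-separable s
... | inj₁ refl = contradiction (↭-sym p) ↭.¬x∷xs↭[]
... | inj₂ q    = subst Separable (standardise-↭ (suc n) p) q

Ssep-unique : ∀ n → Unique (Ssep n)
Ssep-unique n = Unique.filter⁺ separable? (S-unique n)

∈-Ssep⁻ : ∀ n → σ ∈ Ssep n → Separable σ × σ ↭ [1⋯ n ]
∈-Ssep⁻ n σ∈ = let σ∈S , p = ∈-filter⁻ separable? {xs = S n} σ∈ in p , Equivalence.to (∈-S n) σ∈S

∈-Ssep⁺ : ∀ n → Separable σ → σ ↭ [1⋯ n ] → σ ∈ Ssep n
∈-Ssep⁺ n p q = ∈-filter⁺ separable? (Equivalence.from (∈-S n) q) p

∈-Ssep-length : ∀ n → σ ∈ Ssep n → length σ ≡ n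
∈-Ssep-length n σ∈ = trans (↭.↭-length (proj₂ (∈-Ssep⁻ n σ∈))) (List.length-applyUpTo suc n)

separable-∈-Ssep : Separable σ → σ ∈ Ssep (length σ)
separable-∈-Ssep p = ∈-Ssep⁺ _ p (separable-↭ p)

unique-permutation : σ ↭ [1⋯ n ] → Unique σ
unique-permutation p = ↭ₛ.Unique-resp-↭ (setoid ℕ) (Perm.↭⇒↭ₛ (↭-sym p))
  (Unique.applyUpTo⁺₁ suc _ λ i<j _ → <⇒≢ i<j ∘ suc-injective)

take-++ : (ys zs : List X) → take (length ys) (ys ++ zs) ≡ ys
take-++ []       zs = refl
take-++ (y ∷ ys) zs = cong (y ∷_) (take-++ ys zs)

take-drop-++ : (xs ys zs : List X) → take (length ys) (drop (length xs) (xs ++ ys ++ zs)) ≡ ys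
take-drop-++ (x ∷ xs) ys zs = take-drop-++ xs ys zs
take-drop-++ []       ys zs = take-++ ys zs

-- Inflating one point and collapsing a block.

-- The block consists of the l + 1 values k + 1,…,k + l + 1; collapsing it
-- turns it into the single value k + 1.

module Inflation (k l : ℕ) where

  block : List ℕ
  block = applyUpTo (λ i → suc (k + i)) (suc l)

  private
    top : ℕ
    top = suc k + l

    upper lower : ℕ → List ℕ
    upper = applyUpTo (λ i → suc (k + (suc l + i)))
    lower = applyUpTo (λ i → suc (k + suc i))

  inflateAt : List ℕ → ℕ → List ℕ
  inflateAt τ x with <-cmp x (suc k)
  ... | tri< _ _ _ = [ x ]
  ... | tri≈ _ _ _ = map (k +_) τ
  ... | tri> _ _ _ = [ x + l ]

  -- Only the least value of the block survives, and the gap is closed. The result is a subsequence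
  -- up to relabelling, so separability is kept wherever the block stands.
  deflateAt : ℕ → List ℕ
  deflateAt x with x ≤? suc k | x ≤? top
  ... | yes _ | _     = [ x ]
  ... | no _  | yes _ = []
  ... | no _  | no _  = [ x ∸ l ]

  extractAt : ℕ → List ℕ
  extractAt x with x ≤? k | x ≤? top
  ... | yes _ | _     = []
  ... | no _  | yes _ = [ x ∸ k ]
  ... | no _  | no _  = []

  inflate : List ℕ → List ℕ → List ℕ
  inflate π τ = concatMap (inflateAt τ) π

  deflate extract : List ℕ → List ℕ
  deflate = concatMap deflateAt
  extract = concatMap extractAt

  inflateAt-< : x < suc k → inflateAt τ x ≡ [ x ]
  inflateAt-< {x} x< with <-cmp x (suc k)
  ... | tri< _ _ _  = refl
  ... | tri≈ x≮ _ _ = contradiction x< x≮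
  ... | tri> x≮ _ _ = contradiction x< x≮

  inflateAt-≡ : x ≡ suc k → inflateAt τ x ≡ map (k +_) τ
  inflateAt-≡ {x} x≡ with <-cmp x (suc k)
  ... | tri< _ x≢ _ = contradiction x≡ x≢
  ... | tri≈ _ _ _  = refl
  ... | tri> _ x≢ _ = contradiction x≡ x≢

  inflateAt-> : suc k < x → inflateAt τ x ≡ [ x + l ]
  inflateAt-> {x} x> with <-cmp x (suc k)
  ... | tri< _ _ x≯ = contradiction x> x≯
  ... | tri≈ _ _ x≯ = contradiction x> x≯
  ... | tri> _ _ _  = refl

  deflateAt-low : x ≤ suc k → deflateAt x ≡ [ x ]
  deflateAt-low {x} x≤ with x ≤? suc k | x ≤? top
  ... | yes _ | _ = refl
  ... | no x≰ | _ = contradiction x≤ x≰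

  deflateAt-mid : suc k < x → x ≤ top → deflateAt x ≡ []
  deflateAt-mid {x} x> x≤ with x ≤? suc k | x ≤? top
  ... | yes x≤k | _     = contradiction x≤k (<⇒≱ x>)
  ... | no _    | yes _ = refl
  ... | no _    | no x≰ = contradiction x≤ x≰

  deflateAt-high : top < x → deflateAt x ≡ [ x ∸ l ]
  deflateAt-high {x} x> with x ≤? suc k | x ≤? top
  ... | yes x≤k | _     = contradiction (≤-trans x≤k (m≤m+n (suc k) l)) (<⇒≱ x>)
  ... | no _    | yes x≤ = contradiction x≤ (<⇒≱ x>)
  ... | no _    | no _  = refl

  extractAt-low : x ≤ k → extractAt x ≡ []
  extractAt-low {x} x≤ with x ≤? k | x ≤? top
  ... | yes _ | _ = refl
  ... | no x≰ | _ = contradiction x≤ x≰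

  extractAt-mid : k < x → x ≤ top → extractAt x ≡ [ x ∸ k ]
  extractAt-mid {x} x> x≤ with x ≤? k | x ≤? top
  ... | yes x≤k | _     = contradiction x≤k (<⇒≱ x>)
  ... | no _    | yes _ = refl
  ... | no _    | no x≰ = contradiction x≤ x≰

  extractAt-high : top < x → extractAt x ≡ []
  extractAt-high {x} x> with x ≤? k | x ≤? top
  ... | yes _ | _      = refl
  ... | no _  | yes x≤ = contradiction x≤ (<⇒≱ x>)
  ... | no _  | no _   = refl

  private
    raised-≤top : y ≤ suc l → k + y ≤ top
    raised-≤top y≤ = ≤-trans (+-monoʳ-≤ k y≤) (≤-reflexive (+-suc k l))

    high-∸ : top < x → suc k < x ∸ l
    high-∸ {x} x> = subst (_< x ∸ l) (m+n∸n≡m (suc k) l) (∸-monoˡ-< x> (m≤n+m l (suc k)))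

    l≤high : top < x → l ≤ x
    l≤high x> = ≤-trans (m≤n+m l (suc k)) (<⇒≤ x>)

  ∈-block : x ∈ block → k < x × x ≤ top
  ∈-block x∈ with ∈-applyUpTo⁻ (λ i → suc (k + i)) x∈
  ... | i , s≤s i≤l , refl = s≤s (m≤m+n k i) , s≤s (+-monoʳ-≤ k i≤l)

  block-∈ : k < x → x ≤ top → x ∈ block
  block-∈ {x} k<x x≤ = subst (_∈ block) (m+[n∸m]≡n k<x)
    (∈-applyUpTo⁺ (λ i → suc (k + i)) (s≤s (≤-trans (∸-monoˡ-≤ (suc k) x≤) (≤-reflexive (m+n∸m≡n (suc k) l)))))

  raise-block : map (k +_) [1⋯ suc l ] ≡ block
  raise-block = trans (List.map-applyUpTo suc (k +_) (suc l)) (applyUpTo-cong (+-suc k) (suc l))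

  lower-block : map (_∸ k) block ≡ [1⋯ suc l ]
  lower-block = trans (List.map-applyUpTo (λ i → suc (k + i)) (_∸ k) (suc l))
    (applyUpTo-cong (λ i → trans (cong (_∸ k) (sym (+-suc k i))) (m+n∸m≡n k (suc i))) (suc l))

  inflateAt-strictlyMonotone : (∀ {t} → t ∈ τ → 1 ≤ t × t ≤ suc l) → StrictlyMonotone (inflateAt τ)
  inflateAt-strictlyMonotone {τ} bounds =
    retraction⇒strictlyMonotone (inflateAt τ) collapse
      (λ u≤v → +-mono-≤ (⊓-monoˡ-≤ (suc k) u≤v) (∸-monoˡ-≤ top u≤v)) inv
    where
    -- The monotone left inverse: the identity below the block, constantly k + 1 on it, and a shift
    -- by `l` above it.
    collapse : ℕ → ℕ
    collapse u = (u ⊓ suc k) + (u ∸ top)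

    inv : ∀ x {u} → u ∈ inflateAt τ x → collapse u ≡ x
    inv x u∈ with <-cmp x (suc k)
    inv x (here refl) | tri< x< _ _ = trans
      (cong₂ _+_ (m≤n⇒m⊓n≡m (<⇒≤ x<)) (m≤n⇒m∸n≡0 (≤-trans (<⇒≤ x<) (m≤m+n (suc k) l)))) (+-identityʳ x)
    inv x u∈ | tri≈ _ refl _ with ∈-map⁻ (k +_) u∈
    ... | t , t∈ , refl = trans
      (cong₂ _+_ (m≥n⇒m⊓n≡n (subst (_≤ k + t) (+-comm k 1) (+-monoʳ-≤ k (proj₁ (bounds t∈)))))
                 (m≤n⇒m∸n≡0 (raised-≤top (proj₂ (bounds t∈))))) (+-identityʳ x)
    inv x (here refl) | tri> _ _ x> = trans
      (cong₂ _+_ (m≥n⇒m⊓n≡n (≤-trans (<⇒≤ x>) (m≤m+n x l))) (trans (cong₂ _∸_ (+-comm x l) (+-comm (suc k) l)) ([m+n]∸[m+o]≡n∸o l x (suc k))))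
      (m+[n∸m]≡n (<⇒≤ x>))

  deflateAt-strictlyMonotone : StrictlyMonotone deflateAt
  deflateAt-strictlyMonotone {x} {y} x<y u∈ v∈ with x ≤? suc k | x ≤? top | y ≤? suc k | y ≤? top
  deflateAt-strictlyMonotone x<y (here refl) (here refl) | yes _ | _ | yes _ | _ = x<y
  deflateAt-strictlyMonotone x<y (here refl) (here refl) | yes x≤ | _ | no _ | no y≰ =
    ≤-<-trans x≤ (high-∸ (≰⇒> y≰))
  deflateAt-strictlyMonotone x<y (here refl) (here refl) | no x≰ | no _ | yes y≤ | _ =
    contradiction (≤-trans (<⇒≤ x<y) y≤) x≰
  deflateAt-strictlyMonotone x<y (here refl) (here refl) | no _ | no x≰ | no _ | no _ =
    ∸-monoˡ-< x<y (l≤high (≰⇒> x≰))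

  extractAt-strictlyMonotone : StrictlyMonotone extractAt
  extractAt-strictlyMonotone = retraction⇒strictlyMonotone extractAt (k +_) (+-monoʳ-≤ k) inv
    where
    inv : ∀ x {u} → u ∈ extractAt x → k + u ≡ x
    inv x u∈ with x ≤? k | x ≤? top
    inv x (here refl) | no x≰ | yes _ = m+[n∸m]≡n (<⇒≤ (≰⇒> x≰))

  Sep-inflateAt : (∀ {t} → t ∈ τ → 1 ≤ t × t ≤ suc l) → Sep τ → ∀ x → Sep (inflateAt τ x)
  Sep-inflateAt bounds p x with <-cmp x (suc k)
  ... | tri< _ _ _ = point x
  ... | tri≈ _ _ _ = Sep-raise k p
  ... | tri> _ _ _ = point (x + l)

  Sep-deflateAt : ∀ x → Sep (deflateAt x)
  Sep-deflateAt x with x ≤? suc k | x ≤? top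
  ... | yes _ | _     = point x
  ... | no _  | yes _ = empty
  ... | no _  | no _  = point (x ∸ l)

  Sep-extractAt : ∀ x → Sep (extractAt x)
  Sep-extractAt x with x ≤? k | x ≤? top
  ... | yes _ | _     = empty
  ... | no _  | yes _ = point (x ∸ k)
  ... | no _  | no _  = empty

  deflate-block : deflate block ≡ [ suc k ]
  deflate-block
    rewrite deflateAt-low {suc (k + 0)} (s≤s (≤-reflexive (+-identityʳ k)))
          | concatMap-[] {f = deflateAt} (lower l) (λ x∈ → let i , i<l , eq = ∈-applyUpTo⁻ (λ i → suc (k + suc i)) x∈ in
              subst (λ x → deflateAt x ≡ []) (sym eq)
                (deflateAt-mid (s≤s (m<m+n k (s≤s z≤n))) (s≤s (+-monoʳ-≤ k i<l))))
          | +-identityʳ k = refl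

  private
    [1⋯]-block : ∀ r → [1⋯ k + (suc l + r) ] ≡ [1⋯ k ] ++ block ++ upper r
    [1⋯]-block r = trans (applyUpTo-++ suc k (suc l + r))
      (cong ([1⋯ k ] ++_) (applyUpTo-++ (λ i → suc (k + i)) (suc l) r))

    [1⋯]-point : ∀ r → [1⋯ k + suc r ] ≡ [1⋯ k ] ++ suc k ∷ lower r
    [1⋯]-point r = trans (applyUpTo-++ suc k (suc r))
      (cong (λ x → [1⋯ k ] ++ suc x ∷ lower r) (+-identityʳ k))

    ∈-upper : ∀ r → x ∈ upper r → top < x
    ∈-upper r x∈ with ∈-applyUpTo⁻ (λ i → suc (k + (suc l + i))) x∈
    ... | i , _ , refl = s≤s (≤-trans (≤-reflexive (sym (+-suc k l))) (+-monoʳ-≤ k (m≤m+n (suc l) i)))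

    ∈-lower : ∀ r → x ∈ lower r → suc k < x
    ∈-lower r x∈ with ∈-applyUpTo⁻ (λ i → suc (k + suc i)) x∈
    ... | i , _ , refl = s≤s (m<m+n k (s≤s z≤n))

    shift-lower : ∀ r → map (_+ l) (lower r) ≡ upper r
    shift-lower r = trans (List.map-applyUpTo (λ i → suc (k + suc i)) (_+ l) r) (applyUpTo-cong (arith k l) r)
      where
      arith : ∀ k l i → suc (k + suc i) + l ≡ suc (k + (suc l + i))
      arith = solve-∀

    shift-upper : ∀ r → map (_∸ l) (upper r) ≡ lower r
    shift-upper r = trans (cong (map (_∸ l)) (sym (shift-lower r)))
      (trans (sym (List.map-∘ (lower r))) (trans (List.map-cong (λ x → m+n∸n≡m x l) (lower r)) (List.map-id (lower r))))

  concatMap-++₃ : (f : ℕ → List ℕ) → ∀ xs ys zs →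
                  concatMap f (xs ++ ys ++ zs) ≡ concatMap f xs ++ concatMap f ys ++ concatMap f zs
  concatMap-++₃ f xs ys zs = trans (List.concatMap-++ f xs (ys ++ zs))
    (cong (concatMap f xs ++_) (List.concatMap-++ f ys zs))

  -- `concatMap` respects `_↭_`, so inflating the identity is enough. Here `r` is the number of
  -- values above the block, which writes n without subtraction.
  inflate-↭ : ∀ r → π ↭ [1⋯ k + suc r ] → τ ↭ [1⋯ suc l ] → inflate π τ ↭ [1⋯ k + (suc l + r) ]
  inflate-↭ {π} {τ} r p q = ↭-trans (concatMap-↭ (inflateAt τ) p) (↭-trans (↭-reflexive eq)
    (↭-trans (↭.++⁺ˡ [1⋯ k ] (↭.++⁺ʳ (upper r)
               (↭-trans (↭.map⁺ (k +_) q) (↭-reflexive raise-block))))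
             (↭-reflexive (sym ([1⋯]-block r)))))
    where
    eq : inflate [1⋯ k + suc r ] τ ≡ [1⋯ k ] ++ map (k +_) τ ++ upper r
    eq = trans (cong (concatMap (inflateAt τ)) ([1⋯]-point r))
      (trans (concatMap-++₃ (inflateAt τ) [1⋯ k ] [ suc k ] (lower r))
      (cong₂ _++_ (concatMap-id [1⋯ k ] (λ x∈ → inflateAt-< (s≤s (proj₂ (∈-[1⋯] x∈)))))
      (cong₂ _++_ (trans (List.++-identityʳ (inflateAt τ (suc k))) (inflateAt-≡ refl))
        (trans (concatMap-[-] (_+ l) (lower r) (λ x∈ → inflateAt-> (∈-lower r x∈))) (shift-lower r)))))

  deflate-↭ : ∀ r → σ ↭ [1⋯ k + (suc l + r) ] → deflate σ ↭ [1⋯ k + suc r ]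
  deflate-↭ r p = ↭-trans (concatMap-↭ deflateAt p) (↭-reflexive
    (trans (cong deflate ([1⋯]-block r))
    (trans (concatMap-++₃ deflateAt [1⋯ k ] block (upper r))
    (trans (cong₂ _++_ (concatMap-id [1⋯ k ] (λ x∈ → deflateAt-low (m≤n⇒m≤1+n (proj₂ (∈-[1⋯] x∈)))))
           (cong₂ _++_ deflate-block
             (trans (concatMap-[-] (_∸ l) (upper r) (λ x∈ → deflateAt-high (∈-upper r x∈))) (shift-upper r))))
    (sym ([1⋯]-point r))))))

  extract-block : (∀ {x} → x ∈ xs → k < x × x ≤ top) → extract xs ≡ map (_∸ k) xs
  extract-block {xs} h = concatMap-[-] (_∸ k) xs λ x∈ → extractAt-mid (proj₁ (h x∈)) (proj₂ (h x∈))

  extract-↭ : ∀ r → σ ↭ [1⋯ k + (suc l + r) ] → extract σ ↭ [1⋯ suc l ]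
  extract-↭ r p = ↭-trans (concatMap-↭ extractAt p) (↭-reflexive
    (trans (cong extract ([1⋯]-block r))
    (trans (concatMap-++₃ extractAt [1⋯ k ] block (upper r))
    (trans (cong₂ _++_ (concatMap-[] [1⋯ k ] (λ x∈ → extractAt-low (proj₂ (∈-[1⋯] x∈))))
           (cong₂ _++_ (trans (extract-block ∈-block) lower-block)
             (concatMap-[] (upper r) (λ x∈ → extractAt-high (∈-upper r x∈)))))
    (List.++-identityʳ [1⋯ suc l ])))))

  deflate-inflate : ∀ π → τ ↭ [1⋯ suc l ] → deflate (inflate π τ) ≡ π
  deflate-inflate {τ} π q = trans (concatMap-concatMap deflateAt (inflateAt τ) π) (concatMap-id π λ {x} _ → at x)
    where
    at : ∀ x → deflate (inflateAt τ x) ≡ [ x ]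
    at x with <-cmp x (suc k)
    ... | tri< x< _ _ = trans (List.++-identityʳ (deflateAt x)) (deflateAt-low (<⇒≤ x<))
    -- The block stands in the order given by `τ`, but its collapse is a permutation of a singleton
    -- and hence equal to it.
    ... | tri≈ _ refl _ = ↭.↭-singleton-inv (↭-trans
      (concatMap-↭ deflateAt (↭-trans (↭.map⁺ (k +_) q) (↭-reflexive raise-block))) (↭-reflexive deflate-block))
    ... | tri> _ _ x> = trans (List.++-identityʳ (deflateAt (x + l)))
      (trans (deflateAt-high (+-monoˡ-< l x>)) (cong [_] (m+n∸n≡m x l)))

  -- The entry k + 1 occurs exactly once in `π`, so exactly one copy of `τ` is inserted, and all
  -- other entries land outside the block.
  extract-inflate : ∀ r → π ↭ [1⋯ k + suc r ] → τ ↭ [1⋯ suc l ] → extract (inflate π τ) ≡ τ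
  extract-inflate {π} {τ} r p q with ∈-∃++ (↭.∈-resp-↭ (↭-sym p) (subst (suc k ∈_) (sym ([1⋯]-point r)) (∈-++⁺ʳ [1⋯ k ] (here refl))))
  ... | as , bs , refl = trans (concatMap-concatMap extractAt (inflateAt τ) (as ++ suc k ∷ bs))
    (trans (concatMap-++₃ (λ x → extract (inflateAt τ x)) as [ suc k ] bs)
    (trans (cong₂ _++_ (concatMap-[] as λ {x} x∈ → outside x λ { refl → unique-++-disjoint u x∈ (here refl) })
           (cong₂ _++_ (trans (List.++-identityʳ _) inside)
                       (concatMap-[] bs λ {x} x∈ → outside x λ { refl → unique-++-disjoint (drop-as as u) (here refl) x∈ })))
    (List.++-identityʳ τ)))
    where
    u : Unique (as ++ suc k ∷ bs)
    u = unique-permutation p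

    drop-as : ∀ as → Unique (as ++ suc k ∷ bs) → Unique ([ suc k ] ++ bs)
    drop-as []       u       = u
    drop-as (a ∷ as) (_ ∷ u) = drop-as as u

    outside : ∀ x → x ≢ suc k → extract (inflateAt τ x) ≡ []
    outside x x≢ with <-cmp x (suc k)
    ... | tri< (s≤s x≤) _ _ = trans (List.++-identityʳ (extractAt x)) (extractAt-low x≤)
    ... | tri≈ _ x≡ _ = contradiction x≡ x≢
    ... | tri> _ _ x> = trans (List.++-identityʳ (extractAt (x + l))) (extractAt-high (+-monoˡ-< l x>))

    inside : extract (inflateAt τ (suc k)) ≡ τ
    inside = trans (cong extract (inflateAt-≡ refl))
      (trans (extract-block λ y∈ → let t , t∈ , eq = ∈-map⁻ (k +_) y∈
                                       1≤t , t≤ = ∈-[1⋯] (↭.∈-resp-↭ q t∈) in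
               subst (λ y → k < y × y ≤ top) (sym eq) (m<m+n k 1≤t , raised-≤top t≤))
      (trans (sym (List.map-∘ τ)) (trans (List.map-cong (m+n∸m≡n k) τ) (List.map-id τ))))

  inflate-A : ∀ r → π ↭ [1⋯ k + suc r ] → τ ↭ [1⋯ suc l ] → A (suc l) (suc k) (inflate π τ)
  inflate-A {π} {τ} r p q with ∈-∃++ (↭.∈-resp-↭ (↭-sym p) (subst (suc k ∈_) (sym ([1⋯]-point r)) (∈-++⁺ʳ [1⋯ k ] (here refl))))
  ... | as , bs , refl = length as′ , bound , mk⇔ (↭.∈-resp-↭ window) (↭.∈-resp-↭ (↭-sym window))
    where
    as′ = inflate as τ
    bs′ = inflate bs τ
    mid = map (k +_) τ

    eq : inflate (as ++ suc k ∷ bs) τ ≡ as′ ++ mid ++ bs′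
    eq = trans (concatMap-++₃ (inflateAt τ) as [ suc k ] bs)
      (cong (λ ys → as′ ++ ys ++ bs′) (trans (List.++-identityʳ _) (inflateAt-≡ refl)))

    len : length mid ≡ suc l
    len = trans (List.length-map (k +_) τ) (trans (↭.↭-length q) (List.length-applyUpTo suc (suc l)))

    bound : length as′ + suc l ≤ length (inflate (as ++ suc k ∷ bs) τ)
    bound rewrite eq | List.length-++ as′ {mid ++ bs′} | List.length-++ mid {bs′} | len =
      +-monoʳ-≤ (length as′) (m≤m+n (suc l) (length bs′))

    window : take (suc l) (drop (length as′) (inflate (as ++ suc k ∷ bs) τ)) ↭ block
    window = ↭-trans (↭-reflexive (trans (cong₂ (λ n ys → take n (drop (length as′) ys)) (sym len) eq)
                                         (take-drop-++ as′ mid bs′)))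
      (↭-trans (↭.map⁺ (k +_) q) (↭-reflexive raise-block))

  -- Contiguity enters here: `A` places the whole block in one window `bl`, so reinserting it at the
  -- single point k + 1 puts every value back where it stood.
  inflate-deflate : Unique σ → A (suc l) (suc k) σ → inflate (deflate σ) (extract σ) ≡ σ
  inflate-deflate {σ} u (a , _ , w) = trans (concatMap-concatMap (inflateAt core) deflateAt σ)
    (trans (cong (concatMap f) split)
    (trans (concatMap-++₃ f as bl cs)
    (trans (cong₂ _++_ (concatMap-id as (λ x∈ → outside (λ x∈bl → unique-++-disjoint u′ x∈ (∈-++⁺ˡ x∈bl))))
           (cong₂ _++_ inside
             (concatMap-id cs (λ x∈ → outside (λ x∈bl → unique-++-disjoint u″ x∈bl x∈)))))
    (sym split))))
    where
    core = extract σ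
    as = take a σ
    bl = take (suc l) (drop a σ)
    cs = drop (suc l) (drop a σ)
    f = λ x → inflate (deflateAt x) core

    split : σ ≡ as ++ bl ++ cs
    split = trans (sym (List.take++drop≡id a σ)) (cong (as ++_) (sym (List.take++drop≡id (suc l) (drop a σ))))

    u′ : Unique (as ++ bl ++ cs)
    u′ = subst Unique split u

    u″ : Unique (bl ++ cs)
    u″ = subst Unique (sym (List.take++drop≡id (suc l) (drop a σ))) (Unique.drop⁺ a u)

    -- `A` gives equality as sets only; absence of repetitions upgrades it to a permutation.
    bl↭ : bl ↭ block
    bl↭ = ∼bag⇒↭ (unique∧set⇒bag (Unique.take⁺ (suc l) (Unique.drop⁺ a u))
      (Unique.applyUpTo⁺₁ _ _ λ i<j _ → <⇒≢ i<j ∘ +-cancelˡ-≡ k _ _ ∘ suc-injective) w)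

    off-block : x ∉ bl → x ≤ k ⊎ top < x
    off-block {x} x∉ with x ≤? k | x ≤? top
    ... | yes x≤ | _      = inj₁ x≤
    ... | no x≰  | yes x≤ = contradiction (Equivalence.from w (block-∈ (≰⇒> x≰) x≤)) x∉
    ... | no _   | no x≰  = inj₂ (≰⇒> x≰)

    outside : x ∉ bl → f x ≡ [ x ]
    outside {x} x∉ with off-block x∉
    ... | inj₁ x≤ = trans (cong (λ ys → inflate ys core) (deflateAt-low (m≤n⇒m≤1+n x≤)))
      (trans (List.++-identityʳ (inflateAt core x)) (inflateAt-< (s≤s x≤)))
    ... | inj₂ x> = trans (cong (λ ys → inflate ys core) (deflateAt-high x>))
      (trans (List.++-identityʳ (inflateAt core (x ∸ l)))
        (trans (inflateAt-> (high-∸ x>)) (cong [_] (m∸n+n≡m (l≤high x>)))))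

    bl-bounds : x ∈ bl → k < x × x ≤ top
    bl-bounds = ∈-block ∘ Equivalence.to w

    extract-outside : x ∉ bl → extractAt x ≡ []
    extract-outside x∉ with off-block x∉
    ... | inj₁ x≤ = extractAt-low x≤
    ... | inj₂ x> = extractAt-high x>

    core≡ : core ≡ map (_∸ k) bl
    core≡ = trans (cong extract split)
      (trans (concatMap-++₃ extractAt as bl cs)
      (trans (cong₂ _++_ (concatMap-[] as λ x∈ → extract-outside λ x∈bl → unique-++-disjoint u′ x∈ (∈-++⁺ˡ x∈bl))
             (cong₂ _++_ (extract-block bl-bounds)
               (concatMap-[] cs λ x∈ → extract-outside λ x∈bl → unique-++-disjoint u″ x∈bl x∈)))
      (List.++-identityʳ _)))

    inside : concatMap f bl ≡ bl
    inside = trans (sym (concatMap-concatMap (inflateAt core) deflateAt bl))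
      (trans (cong (concatMap (inflateAt core))
               (↭.↭-singleton-inv (↭-trans (concatMap-↭ deflateAt bl↭) (↭-reflexive deflate-block))))
      (trans (List.++-identityʳ _) (trans (inflateAt-≡ refl)
      (trans (cong (map (k +_)) core≡)
      (trans (sym (List.map-∘ bl))
      (trans (map-cong-∈ bl λ x∈ → m+[n∸m]≡n (<⇒≤ (proj₁ (bl-bounds x∈)))) (List.map-id bl)))))))

∣A∩Ssep∣ : ∀ k l r → length (filter (A? (suc l) (suc k)) (Ssep (k + (suc l + r)))) ≡
                    length (cartesianProduct (Ssep (k + suc r)) (Ssep (suc l)))
∣A∩Ssep∣ k l r = sym (length-bijection (λ (π , τ) → inflate π τ)
  (Unique.cartesianProduct⁺ (Ssep-unique (k + suc r)) (Ssep-unique (suc l)))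
  (Unique.filter⁺ (A? (suc l) (suc k)) (Ssep-unique (k + (suc l + r))))
  (λ {(π , τ)} πτ∈ →
    let π∈ , τ∈ = ∈-cartesianProduct⁻ (Ssep (k + suc r)) (Ssep (suc l)) πτ∈
        πsep , π↭ = ∈-Ssep⁻ (k + suc r) π∈
        τsep , τ↭ = ∈-Ssep⁻ (suc l) τ∈
        τ-bounds  = λ {t} (t∈ : t ∈ τ) → ∈-[1⋯] (↭.∈-resp-↭ τ↭ t∈)
    in ∈-filter⁺ (A? (suc l) (suc k))
         (∈-Ssep⁺ (k + (suc l + r))
           (separable (k + (suc l + r)) (subst (0 <_) (sym (+-suc k (l + r))) (s≤s z≤n))
             (Sep-concatMap (inflateAt τ) (inflateAt-strictlyMonotone τ-bounds)
               (Sep-inflateAt τ-bounds (separable⇒Sep τsep)) (separable⇒Sep πsep))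
             (inflate-↭ r π↭ τ↭))
           (inflate-↭ r π↭ τ↭))
         (inflate-A r π↭ τ↭))
  (λ {(π , τ)} {(π′ , τ′)} p q eq →
    let π∈ , τ∈   = ∈-cartesianProduct⁻ (Ssep (k + suc r)) (Ssep (suc l)) p
        π′∈ , τ′∈ = ∈-cartesianProduct⁻ (Ssep (k + suc r)) (Ssep (suc l)) q
        π↭        = proj₂ (∈-Ssep⁻ (k + suc r) π∈)
        π′↭       = proj₂ (∈-Ssep⁻ (k + suc r) π′∈)
        τ↭        = proj₂ (∈-Ssep⁻ (suc l) τ∈)
        τ′↭       = proj₂ (∈-Ssep⁻ (suc l) τ′∈)
    in cong₂ _,_
      (trans (sym (deflate-inflate π τ↭)) (trans (cong deflate eq) (deflate-inflate π′ τ′↭)))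
      (trans (sym (extract-inflate r π↭ τ↭)) (trans (cong extract eq) (extract-inflate r π′↭ τ′↭))))
  (λ {σ} σ∈ →
    let σ∈Ssep , a = ∈-filter⁻ (A? (suc l) (suc k)) {xs = Ssep (k + (suc l + r))} σ∈
        σsep , σ↭  = ∈-Ssep⁻ (k + (suc l + r)) σ∈Ssep
        σSep       = separable⇒Sep σsep
    in (deflate σ , extract σ)
     , ∈-cartesianProduct⁺
         (∈-Ssep⁺ (k + suc r)
           (separable (k + suc r) (subst (0 <_) (sym (+-suc k r)) (s≤s z≤n))
             (Sep-concatMap deflateAt deflateAt-strictlyMonotone Sep-deflateAt σSep) (deflate-↭ r σ↭))
           (deflate-↭ r σ↭))
         (∈-Ssep⁺ (suc l)
           (Sep⇒separable l
             (Sep-concatMap extractAt extractAt-strictlyMonotone Sep-extractAt σSep) (extract-↭ r σ↭))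
           (extract-↭ r σ↭))
     , inflate-deflate (unique-permutation σ↭) a))
  where
  open Inflation k l
  separable : ∀ n → 0 < n → Sep σ → σ ↭ [1⋯ n ] → Separable σ
  separable (suc n) _ = Sep⇒separable n

-- Direct sum decomposition and the equation for the counts.

first final : List ℕ → ℕ
first []      = 0
first (x ∷ _) = x
final = first ∘ reverse

first-++ : ∀ xs {ys} → 0 < length xs → first (xs ++ ys) ≡ first xs
first-++ (_ ∷ _) _ = refl

first-∈ : ∀ xs → 0 < length xs → first xs ∈ xs
first-∈ (_ ∷ _) _ = here refl

reverse-positive : ∀ xs → 0 < length xs → 0 < length (reverse {A = ℕ} xs)
reverse-positive xs = subst (0 <_) (sym (List.length-reverse xs))

final-++ : ∀ xs {ys} → 0 < length ys → final (xs ++ ys) ≡ final ys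
final-++ xs {ys} 0< = trans (cong first (List.reverse-++ xs ys)) (first-++ (reverse ys) (reverse-positive ys 0<))

final-∈ : ∀ xs → 0 < length xs → final xs ∈ xs
final-∈ xs 0< = ↭.∈-resp-↭ (↭.↭-reverse xs) (first-∈ (reverse xs) (reverse-positive xs 0<))

-- A separable permutation is a direct sum of two separable ones exactly when it is rising, by
-- `direct-rising` and `rising-split`; comparing two entries thus replaces ⊕-decomposability.
Rising : Pred (List ℕ) 0ℓ
Rising σ = first σ < final σ

rising? : Decidable Rising
rising? σ = first σ <? final σ

raise-above : ∀ m {σ} → (∀ {x} → x ∈ σ → 1 ≤ x) → y ∈ map (m +_) σ → m < y
raise-above m h y∈ = let _ , x∈ , eq = ∈-map⁻ (m +_) y∈ in subst (m <_) (sym eq) (m<m+n m (h x∈))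

rising-++ : ∀ m σ γ → 0 < length σ → 0 < length γ → (∀ {x} → x ∈ σ → x ≤ m) →
            (∀ {y} → y ∈ γ → m < y) → Rising (σ ++ γ)
rising-++ m σ γ 0<σ 0<γ low high = subst₂ _<_ (sym (first-++ σ 0<σ)) (sym (final-++ σ 0<γ))
  (≤-<-trans (low (first-∈ σ 0<σ)) (high (final-∈ γ 0<γ)))

falling-++ : ∀ m σ γ → 0 < length σ → 0 < length γ → (∀ {x} → x ∈ σ → m < x) →
             (∀ {y} → y ∈ γ → y ≤ m) → final (σ ++ γ) < first (σ ++ γ)
falling-++ m σ γ 0<σ 0<γ high low = subst₂ _<_ (sym (final-++ σ 0<γ)) (sym (first-++ σ 0<σ))
  (≤-<-trans (low (final-∈ γ 0<γ)) (high (first-∈ σ 0<σ)))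

length-⊕ : ∀ σ τ → length (σ ⊕ τ) ≡ length σ + length τ
length-⊕ σ τ = trans (List.length-++ σ) (cong (length σ +_) (List.length-map (length σ +_) τ))

map-positive : ∀ m xs → 0 < length xs → 0 < length (map (m +_) xs)
map-positive m xs = subst (0 <_) (sym (List.length-map (m +_) xs))

separable-positive : Separable σ → 0 < length σ
separable-positive singleton = s≤s z≤n
separable-positive (direct {σ} {τ} p q) =
  subst (0 <_) (sym (length-⊕ σ τ)) (≤-trans (separable-positive p) (m≤m+n _ _))
separable-positive (skew {σ} {τ} p q) =
  subst (0 <_) (sym (List.length-++ (map (length τ +_) σ))) (≤-trans (separable-positive q) (m≤n+m _ _))

direct-rising : Separable σ → Separable τ → Rising (σ ⊕ τ)
direct-rising {σ} {τ} p q = rising-++ (length σ) σ _ (separable-positive p)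
  (map-positive (length σ) τ (separable-positive q))
  (proj₂ ∘ separable-bounds p) (raise-above (length σ) (proj₁ ∘ separable-bounds q))

skew-falling : Separable σ → Separable τ → final (σ ⊖ τ) < first (σ ⊖ τ)
skew-falling {σ} {τ} p q = falling-++ (length τ) (map (length τ +_) σ) τ
  (map-positive (length τ) σ (separable-positive p)) (separable-positive q)
  (raise-above (length τ) (proj₁ ∘ separable-bounds p)) (proj₂ ∘ separable-bounds q)

-- Reversal exchanges `direct` and `skew` and swaps the two summands.
reverse-separable : Separable σ → Separable (reverse σ)
reverse-separable singleton = singleton
reverse-separable (direct {σ} {τ} p q) = subst Separable
  (trans (cong (λ m → map (m +_) (reverse τ) ++ reverse σ) (List.length-reverse σ))
    (trans (cong (_++ reverse σ) (List.reverse-map (length σ +_) τ))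
           (sym (List.reverse-++ σ (map (length σ +_) τ)))))
  (skew (reverse-separable q) (reverse-separable p))
reverse-separable (skew {σ} {τ} p q) = subst Separable
  (trans (cong (λ m → reverse τ ++ map (m +_) (reverse σ)) (List.length-reverse τ))
    (trans (cong (reverse τ ++_) (List.reverse-map (length τ +_) σ))
           (sym (List.reverse-++ (map (length τ +_) σ) τ))))
  (direct (reverse-separable q) (reverse-separable p))

⊕-assoc : ∀ σ τ υ → (σ ⊕ τ) ⊕ υ ≡ σ ⊕ (τ ⊕ υ)
⊕-assoc σ τ υ = trans (List.++-assoc σ (map (length σ +_) τ) _) (cong (σ ++_)
  (trans (cong (map (length σ +_) τ ++_)
    (trans (List.map-cong (λ x → trans (cong (_+ x) (length-⊕ σ τ)) (+-assoc (length σ) (length τ) x)) υ)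
           (List.map-∘ υ)))
    (sym (List.map-++ (length σ +_) τ (map (length τ +_) υ)))))

-- As long as the left summand still rises, it is split in turn and the sum reassociated.
rising-split : Separable σ → Rising σ →
               ∃₂ λ α β → Separable α × ¬ Rising α × Separable β × α ⊕ β ≡ σ
rising-split singleton  r = contradiction r (<-irrefl refl)
rising-split (skew p q) r = contradiction r (<-asym (skew-falling p q))
rising-split (direct {σ} {τ} p q) r with rising? σ
... | no ¬r = σ , τ , p , ¬r , q , refl
... | yes rσ with rising-split p rσ
...   | α , β , pα , ¬rα , pβ , refl = α , β ⊕ τ , pα , ¬rα , direct pβ q , sym (⊕-assoc α β τ)

++-compare : (as bs : List X) {cs ds : List X} → as ++ cs ≡ bs ++ ds →
             (∃ λ γ → bs ≡ as ++ γ × cs ≡ γ ++ ds) ⊎ (∃ λ γ → as ≡ bs ++ γ × ds ≡ γ ++ cs)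
++-compare []       bs       eq = inj₁ (bs , refl , eq)
++-compare (a ∷ as) []       eq = inj₂ (a ∷ as , refl , sym eq)
++-compare (a ∷ as) (b ∷ bs) eq with List.∷-injective eq
... | refl , eq′ with ++-compare as bs eq′
...   | inj₁ (γ , p , q) = inj₁ (γ , cong (a ∷_) p , q)
...   | inj₂ (γ , p , q) = inj₂ (γ , cong (a ∷_) p , q)

-- A longer first summand would start in the shorter one and end above it.
⊕-injective : ∀ {α α′ β β′} → Separable α → ¬ Rising α → Separable β →
              Separable α′ → ¬ Rising α′ → Separable β′ → α ⊕ β ≡ α′ ⊕ β′ → α ≡ α′ × β ≡ β′
⊕-injective {α} {α′} {β} {β′} p ¬r q p′ ¬r′ q′ eq with ++-compare α α′ eq
... | inj₁ ([] , refl , eq′) =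
  sym (List.++-identityʳ α) , List.map-injective (+-cancelˡ-≡ (length α) _ _)
    (trans eq′ (cong (λ ys → map (length ys +_) β′) (List.++-identityʳ α)))
... | inj₁ (c ∷ γ , refl , eq′) = contradiction
  (rising-++ (length α) α (c ∷ γ) (separable-positive p) (s≤s z≤n) (proj₂ ∘ separable-bounds p)
    (λ y∈ → raise-above (length α) (proj₁ ∘ separable-bounds q) (subst (_ ∈_) (sym eq′) (∈-++⁺ˡ y∈)))) ¬r′
... | inj₂ ([] , refl , eq′) =
  List.++-identityʳ α′ , List.map-injective (+-cancelˡ-≡ (length α′) _ _)
    (trans (cong (λ ys → map (length ys +_) β) (sym (List.++-identityʳ α′))) (sym eq′))
... | inj₂ (c ∷ γ , refl , eq′) = contradiction
  (rising-++ (length α′) α′ (c ∷ γ) (separable-positive p′) (s≤s z≤n) (proj₂ ∘ separable-bounds p′)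
    (λ y∈ → raise-above (length α′) (proj₁ ∘ separable-bounds q′) (subst (_ ∈_) (sym eq′) (∈-++⁺ˡ y∈)))) ¬r

length-filter-∁ : {P : Pred X 0ℓ} (P? : Decidable P) (xs : List X) →
                  length xs ≡ length (filter (∁? P?) xs) + length (filter P? xs)
length-filter-∁ P? []       = refl
length-filter-∁ P? (x ∷ xs) with P? x
... | yes _ = trans (cong suc (length-filter-∁ P? xs)) (sym (+-suc _ _))
... | no  _ = cong suc (length-filter-∁ P? xs)

length-cartesianProduct : (xs : List X) (ys : List Y) →
                          length (cartesianProduct xs ys) ≡ length xs * length ys
length-cartesianProduct []       ys = refl
length-cartesianProduct (x ∷ xs) ys = trans (List.length-++ (map (x ,_) ys))
  (cong₂ _+_ (List.length-map (x ,_) ys) (length-cartesianProduct xs ys))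

-- Pairs of total size n, following the recursion of `_⊛_` so that `length-pairs` is a direct
-- induction.
pairs : (ℕ → List X) → (ℕ → List Y) → ℕ → List (X × Y)
pairs F G zero    = cartesianProduct (F 0) (G 0)
pairs F G (suc n) = cartesianProduct (F 0) (G (suc n)) ++ pairs (F ∘ suc) G n

length-pairs : (F : ℕ → List X) (G : ℕ → List Y) → length ∘ pairs F G ≗ (length ∘ F) ⊛ (length ∘ G)
length-pairs F G zero    = length-cartesianProduct (F 0) (G 0)
length-pairs F G (suc n) = trans (List.length-++ (cartesianProduct (F 0) (G (suc n))))
  (cong₂ _+_ (length-cartesianProduct (F 0) (G (suc n))) (length-pairs (F ∘ suc) G n))

∈-pairs⁻ : (F : ℕ → List X) (G : ℕ → List Y) → ∀ n {a b} → (a , b) ∈ pairs F G n →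
           ∃₂ λ i j → i + j ≡ n × a ∈ F i × b ∈ G j
∈-pairs⁻ F G zero    ab∈ = 0 , 0 , refl , ∈-cartesianProduct⁻ (F 0) (G 0) ab∈
∈-pairs⁻ F G (suc n) ab∈ with ∈-++⁻ (cartesianProduct (F 0) (G (suc n))) ab∈
... | inj₁ p = 0 , suc n , refl , ∈-cartesianProduct⁻ (F 0) (G (suc n)) p
... | inj₂ p = let i , j , eq , q = ∈-pairs⁻ (F ∘ suc) G n p in suc i , j , cong suc eq , q

∈-pairs⁺ : (F : ℕ → List X) (G : ℕ → List Y) → ∀ i j {a b} → a ∈ F i → b ∈ G j → (a , b) ∈ pairs F G (i + j)
∈-pairs⁺ F G zero    zero    a∈ b∈ = ∈-cartesianProduct⁺ a∈ b∈
∈-pairs⁺ F G zero    (suc j) a∈ b∈ = ∈-++⁺ˡ (∈-cartesianProduct⁺ a∈ b∈)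
∈-pairs⁺ F G (suc i) j       a∈ b∈ =
  ∈-++⁺ʳ (cartesianProduct (F 0) (G (suc i + j))) (∈-pairs⁺ (F ∘ suc) G i j a∈ b∈)

unique-pairs : (F : ℕ → List X) (G : ℕ → List Y) → (∀ n → Unique (F n)) → (∀ n → Unique (G n)) →
               (∀ {i j a} → a ∈ F i → a ∈ F j → i ≡ j) → ∀ n → Unique (pairs F G n)
unique-pairs F G u v graded zero    = Unique.cartesianProduct⁺ (u 0) (v 0)
unique-pairs F G u v graded (suc n) = Unique.++⁺ (Unique.cartesianProduct⁺ (u 0) (v (suc n)))
  (unique-pairs (F ∘ suc) G (u ∘ suc) v (λ p q → suc-injective (graded p q)) n)
  λ (p , q) → let _ , _ , _ , a∈ , _ = ∈-pairs⁻ (F ∘ suc) G n q in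
    0≢1+n (graded (proj₁ (∈-cartesianProduct⁻ (F 0) (G (suc n)) p)) a∈)

rising nonRising : ℕ → List (List ℕ)
rising    n = filter rising? (Ssep n)
nonRising n = filter (∁? rising?) (Ssep n)

∣rising∣ ∣nonRising∣ ∣Ssep∣ : Seq
∣rising∣    = length ∘ rising
∣nonRising∣ = length ∘ nonRising
∣Ssep∣      = length ∘ Ssep

-- The bijection is (α, β) ↦ α ⊕ β: `rising-split` makes it surjective and `⊕-injective` injective.
∣rising∣-⊛ : ∣rising∣ ≗ ∣nonRising∣ ⊛ ∣Ssep∣
∣rising∣-⊛ n = trans (sym (length-bijection (λ (α , β) → α ⊕ β)
  (unique-pairs nonRising Ssep (λ m → Unique.filter⁺ (∁? rising?) (Ssep-unique m)) Ssep-unique graded n)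
  (Unique.filter⁺ rising? (Ssep-unique n)) to inj surj)) (length-pairs nonRising Ssep n)
  where
  nonRising⁻ : ∀ m → σ ∈ nonRising m → σ ∈ Ssep m × ¬ Rising σ
  nonRising⁻ m = ∈-filter⁻ (∁? rising?) {xs = Ssep m}

  graded : ∀ {i j σ} → σ ∈ nonRising i → σ ∈ nonRising j → i ≡ j
  graded {i} {j} p q =
    trans (sym (∈-Ssep-length i (proj₁ (nonRising⁻ i p)))) (∈-Ssep-length j (proj₁ (nonRising⁻ j q)))

  to : ∀ {αβ} → αβ ∈ pairs nonRising Ssep n → proj₁ αβ ⊕ proj₂ αβ ∈ rising n
  to {α , β} αβ∈ with ∈-pairs⁻ nonRising Ssep n αβ∈
  ... | i , j , eq , α∈ , β∈ =
    let α∈′ , _ = nonRising⁻ i α∈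
        pα = proj₁ (∈-Ssep⁻ i α∈′)
        pβ = proj₁ (∈-Ssep⁻ j β∈)
    in ∈-filter⁺ rising?
         (subst (λ m → α ⊕ β ∈ Ssep m)
           (trans (length-⊕ α β) (trans (cong₂ _+_ (∈-Ssep-length i α∈′) (∈-Ssep-length j β∈)) eq))
           (separable-∈-Ssep (direct pα pβ)))
         (direct-rising pα pβ)

  inj : ∀ {αβ αβ′} → αβ ∈ pairs nonRising Ssep n → αβ′ ∈ pairs nonRising Ssep n →
        proj₁ αβ ⊕ proj₂ αβ ≡ proj₁ αβ′ ⊕ proj₂ αβ′ → αβ ≡ αβ′
  inj p q eq with ∈-pairs⁻ nonRising Ssep n p | ∈-pairs⁻ nonRising Ssep n q
  ... | i , j , _ , α∈ , β∈ | i′ , j′ , _ , α′∈ , β′∈ =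
    let α∈Ssep , ¬r   = nonRising⁻ i α∈
        α′∈Ssep , ¬r′ = nonRising⁻ i′ α′∈
        α≡ , β≡ = ⊕-injective (proj₁ (∈-Ssep⁻ i α∈Ssep)) ¬r (proj₁ (∈-Ssep⁻ j β∈))
                    (proj₁ (∈-Ssep⁻ i′ α′∈Ssep)) ¬r′ (proj₁ (∈-Ssep⁻ j′ β′∈)) eq
    in cong₂ _,_ α≡ β≡

  surj : ∀ {σ} → σ ∈ rising n → ∃ λ αβ → αβ ∈ pairs nonRising Ssep n × proj₁ αβ ⊕ proj₂ αβ ≡ σ
  surj σ∈ with ∈-filter⁻ rising? {xs = Ssep n} σ∈
  ... | σ∈Ssep , r with rising-split (proj₁ (∈-Ssep⁻ n σ∈Ssep)) r
  ...   | α , β , pα , ¬r , pβ , refl = (α , β)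
    , subst (λ m → (α , β) ∈ pairs nonRising Ssep m)
        (trans (sym (length-⊕ α β)) (∈-Ssep-length n σ∈Ssep))
        (∈-pairs⁺ nonRising Ssep (length α) (length β)
          (∈-filter⁺ (∁? rising?) (separable-∈-Ssep pα) ¬r) (separable-∈-Ssep pβ))
    , refl

-- Reversal exchanges first and last entry. The permutation of length 1 does not rise in either
-- direction and accounts for `𝐱`.
∣nonRising∣≡ : ∣nonRising∣ ≗ 𝐱 ⊞ ∣rising∣
∣nonRising∣≡ zero          = refl
∣nonRising∣≡ (suc zero)    = refl
∣nonRising∣≡ n@(suc (suc _)) = sym (length-bijection reverse
  (Unique.filter⁺ rising? (Ssep-unique n)) (Unique.filter⁺ (∁? rising?) (Ssep-unique n))
  (λ {σ} σ∈ → let σ∈Ssep , r = ∈-filter⁻ rising? {xs = Ssep n} σ∈ in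
    ∈-filter⁺ (∁? rising?) (reverse-∈ σ∈Ssep)
      (<-asym (subst (_< final σ) (sym (cong first (List.reverse-involutive σ))) r)))
  (λ _ _ → List.reverse-injective)
  (λ {σ} σ∈ → let σ∈Ssep , ¬r = ∈-filter⁻ (∁? rising?) {xs = Ssep n} σ∈ in
    reverse σ
    , ∈-filter⁺ rising? (reverse-∈ σ∈Ssep)
        (subst (final σ <_) (sym (cong first (List.reverse-involutive σ)))
          (falling (proj₁ (∈-Ssep⁻ n σ∈Ssep)) (∈-Ssep-length n σ∈Ssep) ¬r))
    , List.reverse-involutive σ))
  where
  reverse-∈ : σ ∈ Ssep n → reverse σ ∈ Ssep n
  reverse-∈ {σ} σ∈ = subst (λ m → reverse σ ∈ Ssep m)
    (trans (List.length-reverse σ) (∈-Ssep-length n σ∈))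
    (separable-∈-Ssep (reverse-separable (proj₁ (∈-Ssep⁻ n σ∈))))

  falling : Separable σ → length σ ≡ n → ¬ Rising σ → final σ < first σ
  -- `singleton` is excluded by its length and a direct sum would rise, which leaves `skew`.
  falling (direct p q) _ ¬r = contradiction (direct-rising p q) ¬r
  falling (skew p q)   _ _  = skew-falling p q

-- With N and R counting non-rising and rising permutations, S = N + R and N = x + R give S = x + 2
-- R and 2 N = x + S. Doubling R = N S then yields 2 R = (x + S) S without any halving.
∣Ssep∣-equation : ∣Ssep∣ ≗ 𝐱 ⊞ ∣Ssep∣ ⊛ ∣Ssep∣ ⊞ 𝐱 ⊛ ∣Ssep∣
∣Ssep∣-equation n = trans (split n) (trans (+-assoc (𝐱 n) _ _)
  (trans (cong (𝐱 n +_) (trans (double n) (+-comm ((𝐱 ⊛ ∣Ssep∣) n) _))) (sym (+-assoc (𝐱 n) _ _))))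
  where
  split : ∣Ssep∣ ≗ 𝐱 ⊞ ∣rising∣ ⊞ ∣rising∣
  split n = trans (length-filter-∁ rising? (Ssep n)) (cong (_+ ∣rising∣ n) (∣nonRising∣≡ n))

  nonRising-twice : ∣nonRising∣ ⊞ ∣nonRising∣ ≗ 𝐱 ⊞ ∣Ssep∣
  nonRising-twice n = trans (cong (_+ ∣nonRising∣ n) (∣nonRising∣≡ n)) (trans (+-assoc (𝐱 n) _ _)
    (cong (𝐱 n +_) (trans (+-comm (∣rising∣ n) _) (sym (length-filter-∁ rising? (Ssep n))))))

  double : ∣rising∣ ⊞ ∣rising∣ ≗ 𝐱 ⊛ ∣Ssep∣ ⊞ ∣Ssep∣ ⊛ ∣Ssep∣
  double n = trans (cong₂ _+_ (∣rising∣-⊛ n) (∣rising∣-⊛ n))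
    (trans (sym (⊛-distribʳ ∣Ssep∣ ∣nonRising∣ ∣nonRising∣ n))
    (trans (⊛-cong {g = ∣Ssep∣} nonRising-twice (λ _ → refl) n) (⊛-distribʳ ∣Ssep∣ 𝐱 ∣Ssep∣ n)))

-- From the count to the limit.

sepCount : ℕ → ℕ
sepCount n = length (Ssep (suc n))

-- The sequence starts at s₁, since s₀ = 0 cannot be a denominator.
open Ratios sepCount ∣Ssep∣-nonZero
  (near sepCount refl refl (schröder-recurrence ∣Ssep∣ ∣Ssep∣-equation))

-- Only the total number of values below and above the block survives on the right, and it is `m`
-- for every `k`.
count-A : ∀ l m k → 1 ≤ k → k ≤ suc m →
  length (filter (A? (suc l) k) (Ssep (suc (l + m)))) ≡ length (Ssep (suc l)) * sepCount m
count-A l m (suc k) _ (s≤s k≤m) = trans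
  (cong (λ n → length (filter (A? (suc l) (suc k)) (Ssep n)))
    (trans (cong (λ m → suc (l + m)) (sym (m+[n∸m]≡n k≤m))) (arith l k (m ∸ k))))
  (trans (∣A∩Ssep∣ k l (m ∸ k))
  (trans (length-cartesianProduct (Ssep (k + suc (m ∸ k))) (Ssep (suc l)))
  (trans (*-comm _ (length (Ssep (suc l))))
    (cong (λ n → length (Ssep (suc l)) * length (Ssep n)) (trans (+-suc k (m ∸ k)) (cong suc (m+[n∸m]≡n k≤m)))))))
  where
  arith : ∀ l k r → suc (l + (k + r)) ≡ k + (suc l + r)
  arith = solve-∀

Psep-A : ∀ l m k → 1 ≤ k → k ≤ suc m →
         Psep (suc (l + m)) (A? (suc l) k) ≡ ι (length (Ssep (suc l))) ℚ.* ratio l m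
Psep-A l m k 1≤k k≤ = *-cancelʳ-≡-pos (ι c) {{ι-positive c {{c≢0}}}}
  (trans (/-*-ι p c {{c≢0}})
  (trans (cong ι (count-A l m k 1≤k k≤))
  (trans (ι-* s (sepCount m))
  (trans (cong (ι s ℚ.*_) (sym (/-*-ι (sepCount m) c {{c≢0}}))) (sym (ℚ.*-assoc (ι s) (ratio l m) (ι c)))))))
  where
  p   = length (filter (A? (suc l) k) (Ssep (suc (l + m))))
  s   = length (Ssep (suc l))
  c   = sepCount (l + m)
  c≢0 = ∣Ssep∣-nonZero (l + m)

Psep-⇝ : ∀ l (k : ℕ → ℕ) → (∀ n → suc l < n → 1 ≤ k n × k n ≤ n ∸ suc l + 1) →
  (λ n → Psep n (A? (suc l) (k n))) ⇝ (λ m → ι (length (Ssep (suc l))) ℚ.* seq (3-2√2 ^ᴿ l) m)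
Psep-⇝ l k h = ⇝-eventually (suc l) step (⇝-scale (length (Ssep (suc l))) (ratio-⇝ l))
  where
  step : ∀ n → suc l < n →
         Psep n (A? (suc l) (k n)) ≡ ι (length (Ssep (suc l))) ℚ.* ratio l (n ∸ suc l)
  step n l<n = trans (cong (λ j → Psep j (A? (suc l) (k n))) (sym (m+[n∸m]≡n (<⇒≤ l<n))))
    (Psep-A l (n ∸ suc l) (k n) (proj₁ (h n l<n))
      (≤-trans (proj₂ (h n l<n)) (≤-reflexive (+-comm (n ∸ suc l) 1))))

scaleʳ : (x : ℝ) (k : ℕ) → ∀ m → ι k ℚ.* seq x m ≡ seq (x *ᴿ fromℕ k) m
scaleʳ x k m = ℚ.*-comm (ι k) (seq x m)

scaleˡ : (x : ℝ) (k : ℕ) → ∀ m → ι k ℚ.* seq x m ≡ seq (fromℕ k *ᴿ x) m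
scaleˡ x k m = refl

corollary2 : ((l : ℕ) → 2 ≤ l →
    (k : ℕ → ℕ) → (∀ n → l < n → 1 ≤ k n × k n ≤ n ∸ l + 1) →
    (λ n → fromℚ (Psep n (A? l (k n))))
    ⟶ (fromℕ 3 -ᴿ fromℕ 2 *ᴿ √ 2) ^ᴿ (l ∸ 1) *ᴿ fromℕ (length (Ssep l)))
    ×
    ((k : ℕ → ℕ) → (∀ n → 3 < n → 1 ≤ k n × k n ≤ n ∸ 3 + 1) →
    (λ n → fromℚ (Psep n (A? 3 (k n))))
    ⟶ fromℕ 6 *ᴿ (fromℕ 3 -ᴿ fromℕ 2 *ᴿ √ 2) ^ᴿ 2)
    ×
    ((k : ℕ → ℕ) → (∀ n → 4 < n → 1 ≤ k n × k n ≤ n ∸ 4 + 1) →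
    (λ n → fromℚ (Psep n (A? 4 (k n))))
    ⟶ fromℕ 22 *ᴿ (fromℕ 3 -ᴿ fromℕ 2 *ᴿ √ 2) ^ᴿ 3)
-- The counts 6 and 22 are obtained by evaluating Ssep 3 and Ssep 4.
corollary2 =
  (λ { (suc l) _ k h → ⇝⇒⟶ (3-2√2 ^ᴿ l *ᴿ fromℕ (length (Ssep (suc l))))
    (⇝-cong (λ _ → refl) (scaleʳ (3-2√2 ^ᴿ l) (length (Ssep (suc l)))) (Psep-⇝ l k h)) }) ,
  (λ k h → ⇝⇒⟶ (fromℕ 6 *ᴿ 3-2√2 ^ᴿ 2)
    (⇝-cong (λ _ → refl) (scaleˡ (3-2√2 ^ᴿ 2) 6) (Psep-⇝ 2 k h))) ,
  (λ k h → ⇝⇒⟶ (fromℕ 22 *ᴿ 3-2√2 ^ᴿ 3)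
    (⇝-cong (λ _ → refl) (scaleˡ (3-2√2 ^ᴿ 3) 22) (Psep-⇝ 3 k h)))
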